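{- Let $G$ be a simple graph of order $n$ and $m\ge 1$. Let $\alpha'(G)$ be the size of a maximum matching $M$ of $G$ and $l=n-2\alpha'(G)$ the number of $M$-unsaturated vertices of $G$. Then $s(G\circ P_m)=n\,s(P_m)+\alpha'(G)+l$ if $m\equiv 1\pmod 3$, and $s(G\circ P_m)=n\,s(P_m)$ otherwise.
   Context: A matching in a graph is a set of edges no two of which share a vertex; it is maximal if it is not properly contained in another matching, and maximum if it has the largest possible size. A vertex is $M$-unsaturated if no edge of $M$ is incident to it. The saturation number $s(G)$ is the minimum cardinality of a maximal matching of $G$. $P_m$ is the path on $m$ vertices; $s(P_m)=\lceil m/3\rceil$ if $m\equiv 2\pmod 3$ and $\lfloor m/3\rfloor$ otherwise. The corona $G_1\circ G_2$ is obtained by taking one copy of $G_1$ and $|V(G_1)|$ disjoint copies of $G_2$, and joining the $i$-th vertex of $G_1$ by an edge to every vertex of the $i$-th copy of $G_2$. -}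

module Defs where

open import Data.Empty using (⊥-elim)
open import Data.Fin using (Fin; zero; suc; toℕ)
import Data.Fin.Properties as Fin
open import Data.List using (List; []; _∷_; length; filter; map; allFin; lookup)
open import Data.List.Membership.Propositional.Properties using (∈-lookup)
import Data.List.Membership.Propositional as Prop
import Data.List.Membership.Setoid as SetoidMembership
open import Data.List.Membership.Setoid.Properties using (∈-resp-≈)
import Data.List.Relation.Binary.Subset.Setoid as SetoidSubset
open import Data.List.Relation.Unary.All as All using (All; []; _∷_)
open import Data.List.Relation.Unary.All.Properties using (¬All⇒Any¬)
open import Data.List.Relation.Unary.AllPairs using (AllPairs; []; _∷_; allPairs?)
open import Data.List.Relation.Unary.Any as Any using (Any; here; there)
open import Data.Nat using (ℕ; zero; suc; _+_; _*_; _≤_; z≤n; s≤s; _≟_)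
open import Data.Nat.Properties using (1+n≰n; ≤∧≢⇒<; ≤-pred; 1+n≢n)
open import Data.Product using (Σ; ∃; _×_; _,_; proj₁; proj₂)
open import Data.Product.Function.NonDependent.Propositional using (_×-↔_)
open import Data.Sum using (_⊎_; inj₁; inj₂; swap)
open import Data.Sum.Function.Propositional using (_⊎-↔_)
open import Function using (_∘_)
open import Function.Bundles using (_↔_; module Inverse; module Injection)
open import Function.Construct.Composition using (_↔-∘_)
open import Function.Construct.Identity using (↔-id)
open import Function.Construct.Symmetry using (↔-sym)
open import Function.Properties.Inverse using (↔⇒↣)
open import Level using (0ℓ)
open import Relation.Binary using (Setoid; Decidable; DecidableEquality)
open import Relation.Binary.PropositionalEquality using (_≡_; refl; sym; cong; subst)
open import Relation.Nullary using (¬_; Dec; yes; no; ¬?; contradiction)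
open import Relation.Nullary.Decidable using (map′; _×-dec_; _⊎-dec_; recompute)

record Graph : Set₁ where
  infix 4 _~_
  field
    Vertex    : Set
    order     : ℕ
    enumerate : Vertex ↔ Fin order
    _~_       : Vertex → Vertex → Set
    _~?_      : Decidable _~_
    ~-sym     : ∀ {u v} → u ~ v → v ~ u
    ~-irrefl  : ∀ {v} → ¬ (v ~ v)

  vertices : List Vertex
  vertices = map (Inverse.from enumerate) (allFin order)

  infix 4 _≟ᵛ_
  _≟ᵛ_ : DecidableEquality Vertex
  _≟ᵛ_ = Fin.inj⇒≟ (↔⇒↣ enumerate)

module Matchings (G : Graph) where
  open Graph G

  -- An edge is stored with an arbitrary orientation; _≈_ below forgets it.
  record Edge : Set where
    constructor edge
    field
      end₁ end₂ : Vertex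
      .adjacent : end₁ ~ end₂
  open Edge public

  infix 4 _≈_
  _≈_ : Edge → Edge → Set
  e ≈ f = (end₁ e ≡ end₁ f × end₂ e ≡ end₂ f) ⊎ (end₁ e ≡ end₂ f × end₂ e ≡ end₁ f)

  edgeSetoid : Setoid 0ℓ 0ℓ
  edgeSetoid = record
    { Carrier       = Edge
    ; _≈_           = _≈_
    ; isEquivalence = record
      { refl  = inj₁ (refl , refl)
      ; sym   = λ { (inj₁ (refl , refl)) → inj₁ (refl , refl)
                  ; (inj₂ (refl , refl)) → inj₂ (refl , refl) }
      ; trans = λ { (inj₁ (refl , refl)) q → q
                  ; (inj₂ (refl , refl)) (inj₁ (refl , refl)) → inj₂ (refl , refl)
                  ; (inj₂ (refl , refl)) (inj₂ (refl , refl)) → inj₁ (refl , refl) }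
      }
    }

  open SetoidMembership edgeSetoid using (_∈_)
  open SetoidSubset edgeSetoid using (_⊆_)

  IncidentTo : Vertex → Edge → Set
  IncidentTo v e = v ≡ end₁ e ⊎ v ≡ end₂ e

  Disjoint : Edge → Edge → Set
  Disjoint e f = ¬ ∃ λ v → IncidentTo v e × IncidentTo v f

  -- AllPairs Disjoint also rules out listing an edge twice (in either
  -- orientation), so the length of the list is the cardinality of the edge set.
  record Matching : Set where
    constructor matching
    field
      edges    : List Edge
      disjoint : AllPairs Disjoint edges
  open Matching public

  size : Matching → ℕ
  size M = length (edges M)

  infix 4 _⊂_
  _⊂_ : Matching → Matching → Set
  M ⊂ N = edges M ⊆ edges N × ¬ (edges N ⊆ edges M)

  IsMaximal : Matching → Set
  IsMaximal M = ¬ ∃ λ N → M ⊂ N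

  IsMaximum : Matching → Set
  IsMaximum M = ∀ N → size N ≤ size M

  Unsaturated : Matching → Vertex → Set
  Unsaturated M v = ¬ Any (IncidentTo v) (edges M)

  incidentTo? : Decidable IncidentTo
  incidentTo? v e = (v ≟ᵛ end₁ e) ⊎-dec (v ≟ᵛ end₂ e)

  unsaturated? : ∀ M v → Dec (Unsaturated M v)
  unsaturated? M v = ¬? (Any.any? (incidentTo? v) (edges M))

  #unsaturated : Matching → ℕ
  #unsaturated M = length (filter (unsaturated? M) vertices)

  IsMatchingNumber : ℕ → Set
  IsMatchingNumber k = ∃ λ M → IsMaximum M × size M ≡ k

  IsSaturationNumber : ℕ → Set
  IsSaturationNumber k =
    (∃ λ M → IsMaximal M × size M ≡ k) × (∀ M → IsMaximal M → k ≤ size M)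

  Extendable : List Edge → Set
  Extendable L = ∃ λ e → All (Disjoint e) L

  _≈?_ : Decidable _≈_
  e ≈? f = ((end₁ e ≟ᵛ end₁ f) ×-dec (end₂ e ≟ᵛ end₂ f))
       ⊎-dec ((end₁ e ≟ᵛ end₂ f) ×-dec (end₂ e ≟ᵛ end₁ f))

  ≈-sym : ∀ e f → e ≈ f → f ≈ e
  ≈-sym e f = Setoid.sym edgeSetoid {e} {f}

  ∈-resp : ∀ {L} e f → e ≈ f → e ∈ L → f ∈ L
  ∈-resp e f = ∈-resp-≈ edgeSetoid {x = e} {y = f}

  ≈-incident : ∀ e f {v} → e ≈ f → IncidentTo v e → IncidentTo v f
  ≈-incident _ _ (inj₁ (refl , refl)) p = p
  ≈-incident _ _ (inj₂ (refl , refl)) p = swap p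

  disjoint-sym : ∀ e f → Disjoint e f → Disjoint f e
  disjoint-sym _ _ d (v , p , q) = d (v , q , p)

  anyVertex? : {P : Vertex → Set} → (∀ v → Dec (P v)) → Dec (∃ P)
  anyVertex? {P} P? = map′
    (λ (i , p) → Inverse.from enumerate i , p)
    (λ (v , p) → Inverse.to enumerate v
               , subst P (sym (Inverse.strictlyInverseʳ enumerate v)) p)
    (Fin.any? (P? ∘ Inverse.from enumerate))

  anyEdge? : {P : Edge → Set} → (∀ e → Dec (P e)) → Dec (∃ P)
  anyEdge? {P} P? = map′
    (λ (u , v , a , p) → edge u v a , p)
    (λ { (edge u v a , p) → u , v , recompute (u ~? v) a , p })
    (anyVertex? λ u → anyVertex? λ v → go u v)
    where
    go : ∀ u v → Dec (Σ (u ~ v) λ a → P (edge u v a))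
    go u v with u ~? v
    ... | no ¬a = no (¬a ∘ proj₁)
    ... | yes a with P? (edge u v a)
    ...   | yes p = yes (a , p)
    ...   | no ¬p = no (¬p ∘ proj₂)

  anyList? : ∀ k {P : List Edge → Set} → (∀ L → Dec (P L)) →
             Dec (∃ λ L → length L ≡ k × P L)
  anyList? zero    P? = map′ (λ p → [] , refl , p) (λ { ([] , _ , p) → p }) (P? [])
  anyList? (suc k) P? = map′
    (λ { (e , L , refl , p) → e ∷ L , refl , p })
    (λ { (e ∷ L , refl , p) → e , L , refl , p })
    (anyEdge? λ e → anyList? k (P? ∘ (e ∷_)))

  disjoint? : Decidable Disjoint
  disjoint? e f = ¬? (anyVertex? λ v → incidentTo? v e ×-dec incidentTo? v f)

  extendable? : ∀ L → Dec (Extendable L)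
  extendable? L = anyEdge? λ e → All.all? (disjoint? e) L

  maximal⇒¬extendable : ∀ M → IsMaximal M → ¬ Extendable (edges M)
  maximal⇒¬extendable (matching L d) max (e , e#L) =
    max (matching (e ∷ L) (e#L ∷ d) , (λ {_} → there) , λ sub → clash e#L (sub {e} (here (inj₁ (refl , refl)))))
    where
    clash : ∀ {K} → All (Disjoint e) K → ¬ (e ∈ K)
    clash {f ∷ _} (p ∷ _)  (here e≈f) = p (end₁ e , inj₁ refl , ≈-incident e f e≈f (inj₁ refl))
    clash         (_ ∷ ps) (there i)  = clash ps i

  distinct⇒disjoint : ∀ {L} {e f : Edge} → AllPairs Disjoint L →
    e Prop.∈ L → f Prop.∈ L → ¬ (e ≈ f) → Disjoint e f
  distinct⇒disjoint _        (here refl) (here refl) ≉ = ⊥-elim (≉ (inj₁ (refl , refl)))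
  distinct⇒disjoint (p ∷ _)  (here refl) (there j)   _ = All.lookup p j
  distinct⇒disjoint {e = e} {f} (p ∷ _) (there i) (here refl) _ = disjoint-sym f e (All.lookup p i)
  distinct⇒disjoint (_ ∷ ps) (there i)   (there j)   ≉ = distinct⇒disjoint ps i j ≉

  ⊂⇒extendable : ∀ {M N} → M ⊂ N → Extendable (edges M)
  ⊂⇒extendable {matching L _} {matching K dK} (L⊆K , K⊈L)
    with All.all? (λ e → Any.any? (e ≈?_) L) K
  ... | yes all = ⊥-elim (K⊈L λ {e} e∈K →
          let f , f∈K , e≈f = Prop.find e∈K
          in ∈-resp {L} f e (≈-sym e f e≈f) (All.lookup all f∈K))
  ... | no ¬all =
    let e , e∈K , e∉L = Prop.find (¬All⇒Any¬ (λ e → Any.any? (e ≈?_) L) K ¬all)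
    in e , All.tabulate λ {f} f∈L →
      let f∈ : f ∈ L
          f∈ = Any.map (λ { refl → inj₁ (refl , refl) }) f∈L
          g , g∈K , f≈g = Prop.find (L⊆K {f} f∈)
          e#g = distinct⇒disjoint dK e∈K g∈K λ e≈g →
            e∉L (∈-resp {L} g e (≈-sym e g e≈g) (∈-resp {L} f g f≈g f∈))
      in λ (v , p , q) → e#g (v , p , ≈-incident f g f≈g q)

  ¬extendable⇒maximal : ∀ M → ¬ Extendable (edges M) → IsMaximal M
  ¬extendable⇒maximal M ¬ext (N , M⊂N) = ¬ext (⊂⇒extendable {M} {N} M⊂N)

  size≤order : ∀ M → size M ≤ order
  size≤order (matching L d) = Fin.injective⇒≤ {f = λ i → Inverse.to enumerate (end₁ (lookup L i))}
    λ {i} {j} eq → inj d i j (Injection.injective (↔⇒↣ enumerate) eq)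
    where
    inj : ∀ {L} → AllPairs Disjoint L → ∀ i j → end₁ (lookup L i) ≡ end₁ (lookup L j) → i ≡ j
    inj (_ ∷ _)  zero    zero    _  = refl
    inj (p ∷ _)  zero    (suc j) eq = ⊥-elim (All.lookup p (∈-lookup j) (_ , inj₁ refl , inj₁ eq))
    inj (p ∷ _)  (suc i) zero    eq = ⊥-elim (All.lookup p (∈-lookup i) (_ , inj₁ refl , inj₁ (sym eq)))
    inj (_ ∷ ps) (suc i) (suc j) eq = cong suc (inj ps i j eq)

  least : ∀ {P : ℕ → Set} → (∀ k → Dec (P k)) → ∀ k → P k →
          ∃ λ m → P m × (∀ j → P j → m ≤ j)
  least P? k p with P? 0
  ... | yes p₀ = 0 , p₀ , λ _ _ → z≤n
  least P? zero    p | no ¬p₀ = contradiction p ¬p₀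
  least P? (suc k) p | no ¬p₀ =
    let m , pm , min = least (P? ∘ suc) k p
    in suc m , pm , λ { zero q → contradiction q ¬p₀ ; (suc j) q → s≤s (min j q) }

  greatest : ∀ {P : ℕ → Set} → (∀ k → Dec (P k)) → P 0 → ∀ n → (∀ j → P j → j ≤ n) →
             ∃ λ m → P m × (∀ j → P j → j ≤ m)
  greatest P? p₀ zero    bound = 0 , p₀ , bound
  greatest {P} P? p₀ (suc n) bound with P? (suc n)
  ... | yes p = suc n , p , bound
  ... | no ¬p = greatest P? p₀ n λ j q →
          ≤-pred (≤∧≢⇒< (bound j q) λ eq → ¬p (subst P eq q))

  abstract
    matchingNumber-exists : ∃ IsMatchingNumber
    matchingNumber-exists =
      let k , (L , eq , d) , max = greatest
            {λ k → ∃ λ L → length L ≡ k × AllPairs Disjoint L}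
            (λ k → anyList? k (allPairs? disjoint?)) ([] , refl , []) order
            (λ { _ (L , refl , d) → size≤order (matching L d) })
      in k , matching L d
           , (λ N → subst (size N ≤_) (sym eq) (max (size N) (edges N , refl , disjoint N))) , eq

    saturationNumber-exists : ∃ IsSaturationNumber
    saturationNumber-exists =
      let _ , M₀ , max₀ , _ = matchingNumber-exists
          k , (L , eq , d , ¬ext) , min = least
            {λ k → ∃ λ L → length L ≡ k × AllPairs Disjoint L × ¬ Extendable L}
            (λ k → anyList? k (λ L → allPairs? disjoint? L ×-dec ¬? (extendable? L)))
            (size M₀)
            (edges M₀ , refl , disjoint M₀ , λ (e , e#M₀) →
              1+n≰n (max₀ (matching (e ∷ edges M₀) (e#M₀ ∷ disjoint M₀))))
      in k , (matching L d , ¬extendable⇒maximal (matching L d) ¬ext , eq)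
           , λ M max → min (size M) (edges M , refl , disjoint M , maximal⇒¬extendable M max)

open Matchings public using (Matching; IsMaximal; IsMaximum; IsMatchingNumber; IsSaturationNumber; #unsaturated)

α′ : Graph → ℕ
α′ G = proj₁ (Matchings.matchingNumber-exists G)

α′-spec : ∀ G → IsMatchingNumber G (α′ G)
α′-spec G = proj₂ (Matchings.matchingNumber-exists G)

s : Graph → ℕ
s G = proj₁ (Matchings.saturationNumber-exists G)

s-spec : ∀ G → IsSaturationNumber G (s G)
s-spec G = proj₂ (Matchings.saturationNumber-exists G)

P : ℕ → Graph
P m = record
  { Vertex    = Fin m
  ; order     = m
  ; enumerate = ↔-id (Fin m)
  ; _~_       = λ i j → suc (toℕ i) ≡ toℕ j ⊎ suc (toℕ j) ≡ toℕ i
  ; _~?_      = λ i j → (suc (toℕ i) ≟ toℕ j) ⊎-dec (suc (toℕ j) ≟ toℕ i)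
  ; ~-sym     = swap
  ; ~-irrefl  = λ { (inj₁ eq) → 1+n≢n eq ; (inj₂ eq) → 1+n≢n eq }
  }

module Corona (G H : Graph) where
  private
    module G = Graph G
    module H = Graph H

  -- inj₂ (u , x) is the vertex x of the copy of H attached to the vertex u of G.
  CoronaVertex : Set
  CoronaVertex = G.Vertex ⊎ (G.Vertex × H.Vertex)

  CoronaAdj : CoronaVertex → CoronaVertex → Set
  CoronaAdj (inj₁ u)       (inj₁ v)       = u G.~ v
  CoronaAdj (inj₁ u)       (inj₂ (v , _)) = u ≡ v
  CoronaAdj (inj₂ (u , _)) (inj₁ v)       = u ≡ v
  CoronaAdj (inj₂ (u , x)) (inj₂ (v , y)) = u ≡ v × x H.~ y

  coronaAdj? : Decidable CoronaAdj
  coronaAdj? (inj₁ u)       (inj₁ v)       = u G.~? v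
  coronaAdj? (inj₁ u)       (inj₂ (v , _)) = u G.≟ᵛ v
  coronaAdj? (inj₂ (u , _)) (inj₁ v)       = u G.≟ᵛ v
  coronaAdj? (inj₂ (u , x)) (inj₂ (v , y)) = (u G.≟ᵛ v) ×-dec (x H.~? y)

  coronaAdj-sym : ∀ p q → CoronaAdj p q → CoronaAdj q p
  coronaAdj-sym (inj₁ _) (inj₁ _) a       = G.~-sym a
  coronaAdj-sym (inj₁ _) (inj₂ _) a       = sym a
  coronaAdj-sym (inj₂ _) (inj₁ _) a       = sym a
  coronaAdj-sym (inj₂ _) (inj₂ _) (a , b) = sym a , H.~-sym b

  coronaAdj-irrefl : ∀ p → ¬ CoronaAdj p p
  coronaAdj-irrefl (inj₁ _) a       = G.~-irrefl a
  coronaAdj-irrefl (inj₂ _) (_ , b) = H.~-irrefl b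

  corona : Graph
  corona = record
    { Vertex    = CoronaVertex
    ; order     = G.order + G.order * H.order
    ; enumerate = ↔-sym Fin.+↔⊎ ↔-∘ (G.enumerate ⊎-↔ (↔-sym Fin.*↔× ↔-∘ (G.enumerate ×-↔ H.enumerate)))
    ; _~_       = CoronaAdj
    ; _~?_      = coronaAdj?
    ; ~-sym     = λ {p} {q} → coronaAdj-sym p q
    ; ~-irrefl  = λ {p} → coronaAdj-irrefl p
    }

infixr 7 _⊚_
_⊚_ : Graph → Graph → Graph
G ⊚ H = Corona.corona G H

{-# OPTIONS --safe #-}
-- A matching is an involution of the vertices moving each vertex to itself or to
-- a neighbour; twice its size is the number of moved vertices, and it is maximal
-- when no two adjacent vertices are fixed.  In a maximal matching of G ∘ P_m take
-- a vertex u of G, and let f be the number of edges inside its copy of P_m and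
-- g ∈ {0, 1} the number of edges from u to that copy.  If the copy has fixed
-- vertices, then the right neighbour of each of them but the last one is matched
-- to the right or to u, so there are at most f + g + 1 of them and
-- m ≤ 3f + 2g + 1.  If u is fixed, then m = 2f.  Hence u together with its copy
-- contains at least 2⌈m/3⌉ moved vertices, or at least 2⌈(m − 1)/3⌉ + 1 if u is
-- matched inside G.  Both bounds are attained.  They give
-- s(G ∘ P_m) = n ⌈m/3⌉ if m ≢ 1 (mod 3), and n ⌈m/3⌉ − α′(G) if m ≡ 1 (mod 3),
-- while s(P_m) = ⌈(m − 1)/3⌉.
module Submission where

open import Defs
open import Data.Nat using (ℕ; zero; suc; _+_; _*_; _∸_; _≤_; _≥_; z≤n; s≤s)
open import Data.Nat.DivMod using (_%_)
open import Data.Product using (Σ; ∃; _×_; _,_; proj₁; proj₂)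
open import Relation.Binary.PropositionalEquality using (_≡_; _≢_; refl; sym; trans; cong; cong₂; subst; module ≡-Reasoning)

open import Data.Bool using (if_then_else_)
open import Data.Fin using (Fin; zero; suc; toℕ; _↑ˡ_; _↑ʳ_; combine; remQuot; inject₁; fromℕ)
import Data.Fin as Fin
import Data.Fin.Properties as Fin
open import Data.List using (List; []; _∷_; length; filter; tabulate)
open import Data.List.Membership.Propositional using (_∈_; find)
open import Data.List.Membership.Propositional.Properties using (∈-map⁺; ∈-allFin)
open import Data.List.Properties using (map-tabulate)
open import Data.List.Relation.Unary.All as All using (All; []; _∷_)
open import Data.List.Relation.Unary.AllPairs using (AllPairs; []; _∷_)
open import Data.List.Relation.Unary.Any as Any using (Any; here; there)
open import Data.List.Relation.Unary.Unique.Propositional using (Unique)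
open import Data.List.Relation.Unary.Unique.Propositional.Properties using (map⁺; allFin⁺)
open import Data.Maybe using (Maybe; just; nothing; fromMaybe)
import Data.Maybe as Maybe
import Data.Maybe.Properties as Maybe
import Data.Nat as ℕ
open import Data.Nat.Properties
open import Data.Nat.Tactic.RingSolver using (solve-∀)
import Data.Product as Product
open import Data.Sum using (_⊎_; inj₁; inj₂; [_,_])
import Data.Sum as Sum
open import Data.Sum.Properties using (inj₁-injective)
open import Function using (_∘_; id; case_of_)
open import Function.Bundles using (module Inverse)
open import Relation.Binary.Definitions using (DecidableEquality; tri<; tri≈; tri>)
open import Relation.Nullary using (¬_; Dec; yes; no; does; ¬?; contradiction)
open import Relation.Nullary.Decidable using (_×-dec_; _⊎-dec_; decidable-stable; recompute)
open import Algebra.Properties.CommutativeMonoid.Sum +-0-commutativeMonoid using (sum; sum-cong-≗; ∑-distrib-+; sum-init-last)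

-- Indicators and finite sums

𝟙 : {A : Set} → Dec A → ℕ
𝟙 d = if does d then 1 else 0

𝟙-yes : {A : Set} (d : Dec A) → A → 𝟙 d ≡ 1
𝟙-yes (yes _) _ = refl
𝟙-yes (no ¬a) a = contradiction a ¬a

𝟙-no : {A : Set} (d : Dec A) → ¬ A → 𝟙 d ≡ 0
𝟙-no (yes a) ¬a = contradiction a ¬a
𝟙-no (no _)  _  = refl

𝟙-cong : {A B : Set} (d : Dec A) (e : Dec B) → (A → B) → (B → A) → 𝟙 d ≡ 𝟙 e
𝟙-cong (yes a) e f _ = sym (𝟙-yes e (f a))
𝟙-cong (no ¬a) e _ g = sym (𝟙-no e (¬a ∘ g))

𝟙-⊎ : {A B C : Set} (c : Dec C) (a : Dec A) (b : Dec B) →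
  (C → A ⊎ B) → (A ⊎ B → C) → (A → ¬ B) → 𝟙 c ≡ 𝟙 a + 𝟙 b
𝟙-⊎ c (yes a) (yes b) _ _ ¬both = contradiction b (¬both a)
𝟙-⊎ c (yes a) (no _)  _ g _     = 𝟙-yes c (g (inj₁ a))
𝟙-⊎ c (no _)  (yes b) _ g _     = 𝟙-yes c (g (inj₂ b))
𝟙-⊎ c (no ¬a) (no ¬b) f _ _     = 𝟙-no c ([ ¬a , ¬b ] ∘ f)

𝟙≤1 : {A : Set} (d : Dec A) → 𝟙 d ≤ 1
𝟙≤1 (yes _) = s≤s z≤n
𝟙≤1 (no _)  = z≤n

𝟙-¬ : {A : Set} (d : Dec A) → 𝟙 (¬? d) + 𝟙 d ≡ 1
𝟙-¬ (yes _) = refl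
𝟙-¬ (no _)  = refl

sum-mono-≤ : ∀ {n} {f g : Fin n → ℕ} → (∀ i → f i ≤ g i) → sum f ≤ sum g
sum-mono-≤ {zero}  _   = z≤n
sum-mono-≤ {suc n} f≤g = +-mono-≤ (f≤g zero) (sum-mono-≤ (f≤g ∘ suc))

sum-const : ∀ n c → sum {n} (λ _ → c) ≡ n * c
sum-const zero    c = refl
sum-const (suc n) c = cong (c +_) (sum-const n c)

sum-zero : ∀ {n} {f : Fin n → ℕ} → (∀ i → f i ≡ 0) → sum f ≡ 0
sum-zero {n} f≡0 = trans (sum-cong-≗ f≡0) (trans (sum-const n 0) (*-zeroʳ n))

sum-single : ∀ {n} {f : Fin n → ℕ} i → f i ≡ 1 → (∀ j → j ≢ i → f j ≡ 0) → sum f ≡ 1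
sum-single zero    f≡1 f≡0 = cong₂ _+_ f≡1 (sum-zero λ j → f≡0 (suc j) λ ())
sum-single (suc i) f≡1 f≡0 =
  cong₂ _+_ (f≡0 zero λ ()) (sum-single i f≡1 λ j j≢i → f≡0 (suc j) (j≢i ∘ Fin.suc-injective))

sum-↑ : ∀ a {b} (f : Fin (a + b) → ℕ) → sum f ≡ sum (λ i → f (i ↑ˡ b)) + sum (λ j → f (a ↑ʳ j))
sum-↑ zero    f = refl
sum-↑ (suc a) f = trans (cong (f zero +_) (sum-↑ a (f ∘ suc))) (sym (+-assoc (f zero) _ _))

sum-combine : ∀ a {b} (f : Fin (a * b) → ℕ) → sum f ≡ sum (λ i → sum (λ j → f (combine {a} {b} i j)))
sum-combine zero        f = refl
sum-combine (suc a) {b} f = trans (sum-↑ b f) (cong (sum (λ j → f (j ↑ˡ a * b)) +_) (sum-combine a (f ∘ (b ↑ʳ_))))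

length-filter-tabulate : ∀ {n} {A : Set} {Q : A → Set} (Q? : ∀ x → Dec (Q x)) (f : Fin n → A) →
  length (filter Q? (tabulate f)) ≡ sum (λ i → 𝟙 (Q? (f i)))
length-filter-tabulate {zero}  Q? f = refl
length-filter-tabulate {suc n} Q? f with Q? (f zero)
... | yes _ = cong suc (length-filter-tabulate Q? (f ∘ suc))
... | no _  = length-filter-tabulate Q? (f ∘ suc)

∑ᵛ : (G : Graph) → (Graph.Vertex G → ℕ) → ℕ
∑ᵛ G f = sum (f ∘ Inverse.from (Graph.enumerate G))

-- Matchings as partial involutions

record Pairing (G : Graph) : Set where
  open Graph G
  field
    partner    : Vertex → Vertex
    involutive : ∀ v → partner (partner v) ≡ v
    adjacent   : ∀ v → partner v ≢ v → v ~ partner v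

  moved : Vertex → ℕ
  moved v = 𝟙 (¬? (partner v ≟ᵛ v))

  #moved : ℕ
  #moved = ∑ᵛ G moved

  Stable : Set
  Stable = ∀ {u v} → u ~ v → partner u ≡ u → partner v ≢ v

open Pairing using (#moved; Stable)

module _ (G : Graph) where
  open Graph G
  open Matchings G hiding (_≈_; adjacent; Matching; IsMaximal; IsMaximum; IsMatchingNumber; IsSaturationNumber; #unsaturated)

  private
    index : Vertex → Fin order
    index = Inverse.to enumerate

    from-index : ∀ v → Inverse.from enumerate (index v) ≡ v
    from-index = Inverse.strictlyInverseʳ enumerate

    index-from : ∀ i → index (Inverse.from enumerate i) ≡ i
    index-from = Inverse.strictlyInverseˡ enumerate

  ∑ᵛ-single : ∀ u → ∑ᵛ G (λ v → 𝟙 (v ≟ᵛ u)) ≡ 1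
  ∑ᵛ-single u = sum-single (index u) (𝟙-yes (_ ≟ᵛ _) (from-index u))
    λ j j≢ → 𝟙-no (_ ≟ᵛ _) λ eq → j≢ (trans (sym (index-from j)) (cong index eq))

  saturated? : ∀ L v → Dec (Any (IncidentTo v) L)
  saturated? L v = Any.any? (incidentTo? v) L

  disjoint⇒unsaturated : ∀ e {L v} → All (Disjoint e) L → IncidentTo v e → ¬ Any (IncidentTo v) L
  disjoint⇒unsaturated e e#L v∈e v∈L =
    let f , f∈L , v∈f = find v∈L in All.lookup e#L f∈L (_ , v∈e , v∈f)

  ends-distinct : ∀ e → end₁ e ≢ end₂ e
  ends-distinct (edge u v a) refl = ~-irrefl (recompute (u ~? v) a)

  -- The head edge contributes its two ends, which are distinct because there are no loops, and
  -- disjointness keeps both out of the count for the tail.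
  #saturated : ∀ {L} → AllPairs Disjoint L → ∑ᵛ G (λ v → 𝟙 (saturated? L v)) ≡ 2 * length L
  #saturated {[]}    []        = sum-zero {order} λ _ → refl
  #saturated {e ∷ L} (e#L ∷ d) = begin
    ∑ᵛ G (λ v → 𝟙 (saturated? (e ∷ L) v))
      ≡⟨ sum-cong-≗ (split ∘ Inverse.from enumerate) ⟩
    ∑ᵛ G (λ v → 𝟙 (v ≟ᵛ end₁ e) + (𝟙 (v ≟ᵛ end₂ e) + 𝟙 (saturated? L v)))
      ≡⟨ ∑-distrib-+ {order} _ _ ⟩
    ∑ᵛ G (λ v → 𝟙 (v ≟ᵛ end₁ e)) + ∑ᵛ G (λ v → 𝟙 (v ≟ᵛ end₂ e) + 𝟙 (saturated? L v))
      ≡⟨ cong₂ _+_ (∑ᵛ-single (end₁ e)) (∑-distrib-+ {order} _ _) ⟩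
    1 + (∑ᵛ G (λ v → 𝟙 (v ≟ᵛ end₂ e)) + ∑ᵛ G (λ v → 𝟙 (saturated? L v)))
      ≡⟨ cong (1 +_) (cong₂ _+_ (∑ᵛ-single (end₂ e)) (#saturated d)) ⟩
    2 + 2 * length L
      ≡⟨ *-suc 2 (length L) ⟨
    2 * suc (length L) ∎
    where
    open ≡-Reasoning
    split : ∀ v → 𝟙 (saturated? (e ∷ L) v) ≡ 𝟙 (v ≟ᵛ end₁ e) + (𝟙 (v ≟ᵛ end₂ e) + 𝟙 (saturated? L v))
    split v = trans
      (𝟙-⊎ (saturated? (e ∷ L) v) (incidentTo? v e) (saturated? L v)
        Any.toSum Any.fromSum (disjoint⇒unsaturated e e#L))
      (trans (cong (_+ 𝟙 (saturated? L v)) (𝟙-⊎ (incidentTo? v e) (v ≟ᵛ end₁ e) (v ≟ᵛ end₂ e)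
        id id λ v≡ v≡′ → ends-distinct e (trans (sym v≡) v≡′)))
        (+-assoc (𝟙 (v ≟ᵛ end₁ e)) (𝟙 (v ≟ᵛ end₂ e)) (𝟙 (saturated? L v))))

  #unsaturated+2*size : ∀ M → #unsaturated G M + 2 * size M ≡ order
  #unsaturated+2*size M@(matching L d) = begin
    #unsaturated G M + 2 * size M
      ≡⟨ cong₂ _+_ (cong (length ∘ filter (unsaturated? M)) (map-tabulate id (Inverse.from enumerate))) (sym (#saturated d)) ⟩
    length (filter (unsaturated? M) (tabulate (Inverse.from enumerate))) + ∑ᵛ G (λ v → 𝟙 (saturated? L v))
      ≡⟨ cong (_+ ∑ᵛ G (λ v → 𝟙 (saturated? L v))) (length-filter-tabulate (unsaturated? M) (Inverse.from enumerate)) ⟩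
    ∑ᵛ G (λ v → 𝟙 (unsaturated? M v)) + ∑ᵛ G (λ v → 𝟙 (saturated? L v))
      ≡⟨ ∑-distrib-+ {order} _ _ ⟨
    ∑ᵛ G (λ v → 𝟙 (unsaturated? M v) + 𝟙 (saturated? L v))
      ≡⟨ sum-cong-≗ (λ i → 𝟙-¬ (saturated? L (Inverse.from enumerate i))) ⟩
    sum {order} (λ _ → 1)
      ≡⟨ sum-const order 1 ⟩
    order * 1
      ≡⟨ *-identityʳ order ⟩
    order ∎
    where open ≡-Reasoning

  -- On a list that is not a matching the first edge through `v` decides; pairwise disjointness
  -- makes the map an involution.
  matePartner : List Edge → Vertex → Vertex
  matePartner []      v = v
  matePartner (e ∷ L) v with v ≟ᵛ end₁ e | v ≟ᵛ end₂ e
  ... | yes _ | _     = end₂ e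
  ... | no _  | yes _ = end₁ e
  ... | no _  | no _  = matePartner L v

  unsaturated⇒fixed : ∀ L {v} → ¬ Any (IncidentTo v) L → matePartner L v ≡ v
  unsaturated⇒fixed []      _ = refl
  unsaturated⇒fixed (e ∷ L) {v} ¬sat with v ≟ᵛ end₁ e | v ≟ᵛ end₂ e
  ... | yes p | _     = contradiction (here (inj₁ p)) ¬sat
  ... | no _  | yes p = contradiction (here (inj₂ p)) ¬sat
  ... | no _  | no _  = unsaturated⇒fixed L (¬sat ∘ there)

  fixed⇒unsaturated : ∀ L {v} → matePartner L v ≡ v → ¬ Any (IncidentTo v) L
  fixed⇒unsaturated (e ∷ L) {v} fixed sat with v ≟ᵛ end₁ e | v ≟ᵛ end₂ e
  ... | yes p | _     = ends-distinct e (trans (sym p) (sym fixed))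
  ... | no _  | yes p = ends-distinct e (trans fixed p)
  fixed⇒unsaturated (e ∷ L) {v} fixed (here (inj₁ p)) | no ¬p | no _  = ¬p p
  fixed⇒unsaturated (e ∷ L) {v} fixed (here (inj₂ p)) | no _  | no ¬p = ¬p p
  fixed⇒unsaturated (e ∷ L) {v} fixed (there sat)     | no _  | no _  = fixed⇒unsaturated L fixed sat

  private
    -- Disjointness keeps the end `w` of `e` off `L`, so `L` fixes `w`; applying `matePartner L` to
    -- both sides of `matePartner L v ≡ w` then gives `v` on the left and `w` on the right.
    end-fixed : ∀ {e L v w} → All (Disjoint e) L → matePartner L (matePartner L v) ≡ v →
      matePartner L v ≡ w → IncidentTo w e → v ≡ w
    end-fixed {e} {L} e#L inv eq w∈e =
      trans (sym inv) (trans (cong (matePartner L) eq) (unsaturated⇒fixed L (disjoint⇒unsaturated e e#L w∈e)))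

  matePartner-involutive : ∀ {L} → AllPairs Disjoint L → ∀ v → matePartner L (matePartner L v) ≡ v
  matePartner-involutive []                v = refl
  matePartner-involutive {e ∷ L} (e#L ∷ d) v with v ≟ᵛ end₁ e | v ≟ᵛ end₂ e
  ... | yes p | _ with end₂ e ≟ᵛ end₁ e | end₂ e ≟ᵛ end₂ e
  -- This case would make `e` a loop, but `q` already gives the goal.
  ...   | yes q | _     = trans q (sym p)
  ...   | no _  | yes _ = sym p
  ...   | no _  | no ¬q = contradiction refl ¬q
  matePartner-involutive {e ∷ L} (e#L ∷ d) v | no _ | yes p with end₁ e ≟ᵛ end₁ e
  ...   | yes _ = sym p
  ...   | no ¬q = contradiction refl ¬q
  matePartner-involutive {e ∷ L} (e#L ∷ d) v | no ¬p | no ¬p′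
    with matePartner L v ≟ᵛ end₁ e | matePartner L v ≟ᵛ end₂ e
  -- If the partner of `v` in `L` were an end of `e`, then `v` would be that end, but `v` lies off
  -- `e`.
  ... | yes q | _     = contradiction (end-fixed {e} e#L (matePartner-involutive d v) q (inj₁ refl)) ¬p
  ... | no _  | yes q = contradiction (end-fixed {e} e#L (matePartner-involutive d v) q (inj₂ refl)) ¬p′
  ... | no _  | no _  = matePartner-involutive d v

  matePartner-adjacent : ∀ L v → matePartner L v ≢ v → v ~ matePartner L v
  matePartner-adjacent []      v v≢ = contradiction refl v≢
  matePartner-adjacent (e@(edge a b a~b) ∷ L) v v≢ with v ≟ᵛ end₁ e | v ≟ᵛ end₂ e
  ... | yes refl | _        = recompute (a ~? b) a~b
  ... | no _     | yes refl = ~-sym (recompute (a ~? b) a~b)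
  ... | no _     | no _     = matePartner-adjacent L v v≢

  toPairing : Matching G → Pairing G
  toPairing (matching L d) = record
    { partner = matePartner L ; involutive = matePartner-involutive d ; adjacent = matePartner-adjacent L }

  toPairing-#moved : ∀ M → #moved (toPairing M) ≡ 2 * size M
  toPairing-#moved (matching L d) = trans
    (sum-cong-≗ λ i → let v = Inverse.from enumerate i in 𝟙-cong (¬? (matePartner L v ≟ᵛ v)) (saturated? L v)
      (λ ≢v → decidable-stable (saturated? L v) (≢v ∘ unsaturated⇒fixed L))
      λ sat fixed → fixed⇒unsaturated L fixed sat)
    (#saturated d)

  unsaturated-ends⇒disjoint : ∀ e {L} → (∀ {v} → IncidentTo v e → ¬ Any (IncidentTo v) L) → All (Disjoint e) L
  unsaturated-ends⇒disjoint e unsat = All.tabulate λ f∈L (v , v∈e , v∈f) →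
    unsat v∈e (Any.map (λ { refl → v∈f }) f∈L)

  -- An edge between two fixed vertices would meet no edge of `M` and could be added.
  toPairing-stable : ∀ M → IsMaximal G M → Stable (toPairing M)
  toPairing-stable M@(matching L d) max {u} {v} u~v fixed-u fixed-v =
    maximal⇒¬extendable M max (edge u v u~v , unsaturated-ends⇒disjoint (edge u v u~v) λ
      { (inj₁ refl) → fixed⇒unsaturated L fixed-u ; (inj₂ refl) → fixed⇒unsaturated L fixed-v })

  -- From involutions back to matchings

  module _ (π : Pairing G) where
    open Pairing π using (partner; involutive; adjacent)

    partner-injective : ∀ {u v} → partner u ≡ partner v → u ≡ v
    partner-injective {u} {v} eq = trans (sym (involutive u)) (trans (cong partner eq) (involutive v))

    -- Each pair {v , partner v} is listed once, from its end of smaller index.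
    pairEdges : List Vertex → List Edge
    pairEdges []       = []
    pairEdges (v ∷ vs) with index v Fin.<? index (partner v)
    ... | yes lt = edge v (partner v) (adjacent v λ eq → Fin.<-irrefl (cong index (sym eq)) lt) ∷ pairEdges vs
    ... | no _   = pairEdges vs

    pairEdges-∈ : ∀ vs {e} → e ∈ pairEdges vs →
      end₁ e ∈ vs × end₂ e ≡ partner (end₁ e) × index (end₁ e) Fin.< index (partner (end₁ e))
    pairEdges-∈ (v ∷ vs) e∈ with index v Fin.<? index (partner v)
    pairEdges-∈ (v ∷ vs) (here refl) | yes lt = here refl , refl , lt
    pairEdges-∈ (v ∷ vs) (there e∈)  | yes _  = let i , p = pairEdges-∈ vs e∈ in there i , p
    pairEdges-∈ (v ∷ vs) e∈          | no _   = let i , p = pairEdges-∈ vs e∈ in there i , p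

    -- A vertex shared by two listed edges is the lower end of both, against `Unique`; the upper end
    -- of both, against injectivity of `partner`; or lower in one and upper in the other, which
    -- `cross` excludes by comparing indices.
    pairEdges-disjoint : ∀ {vs} → Unique vs → AllPairs Disjoint (pairEdges vs)
    pairEdges-disjoint {[]}     []        = []
    pairEdges-disjoint {v ∷ vs} (v∉ ∷ uq) with index v Fin.<? index (partner v)
    ... | no _   = pairEdges-disjoint uq
    ... | yes lt = All.tabulate (λ {f} f∈ → clash f (pairEdges-∈ vs f∈)) ∷ pairEdges-disjoint uq
      where
      cross : ∀ {w} → index w Fin.< index (partner w) → v ≢ partner w
      cross {w} lt′ refl = Fin.<-asym lt′ (subst (λ x → index (partner w) Fin.< index x) (involutive w) lt)
      clash : ∀ f → end₁ f ∈ vs × end₂ f ≡ partner (end₁ f) × index (end₁ f) Fin.< index (partner (end₁ f)) →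
        ¬ ∃ λ x → (x ≡ v ⊎ x ≡ partner v) × IncidentTo x f
      clash (edge w _ _) (w∈ , refl , lt′) (x , inj₁ refl , inj₁ refl) = All.lookup v∉ w∈ refl
      clash (edge w _ _) (w∈ , refl , lt′) (x , inj₁ refl , inj₂ eq)   = cross lt′ eq
      clash (edge w _ _) (w∈ , refl , lt′) (x , inj₂ refl , inj₁ eq)   =
        cross lt′ (trans (sym (involutive v)) (cong partner eq))
      clash (edge w _ _) (w∈ , refl , lt′) (x , inj₂ refl , inj₂ eq)   =
        All.lookup v∉ w∈ (partner-injective eq)

    pairEdges-∋ : ∀ {vs v} → v ∈ vs → index v Fin.< index (partner v) →
      Any (IncidentTo v) (pairEdges vs) × Any (IncidentTo (partner v)) (pairEdges vs)
    pairEdges-∋ {w ∷ vs} {v} v∈ lt with index w Fin.<? index (partner w)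
    pairEdges-∋ (here refl) lt | yes _  = here (inj₁ refl) , here (inj₂ refl)
    pairEdges-∋ (here refl) lt | no ¬lt = contradiction lt ¬lt
    pairEdges-∋ (there v∈)  lt | yes _  = let p , q = pairEdges-∋ v∈ lt in there p , there q
    pairEdges-∋ (there v∈)  lt | no _   = pairEdges-∋ v∈ lt

    ∈-vertices : ∀ v → v ∈ vertices
    ∈-vertices v = subst (_∈ vertices) (from-index v) (∈-map⁺ (Inverse.from enumerate) (∈-allFin (index v)))

    fromPairing : Matching G
    fromPairing = matching (pairEdges vertices) (pairEdges-disjoint
      (map⁺ (λ {i} {j} eq → trans (sym (index-from i)) (trans (cong index eq) (index-from j))) (allFin⁺ order)))

    -- The edge is listed from `v` or from `partner v`, whichever has the smaller index; equal
    -- indices would make `v` fixed.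
    moved⇒saturated : ∀ v → partner v ≢ v → Any (IncidentTo v) (edges fromPairing)
    moved⇒saturated v ≢v with Fin.<-cmp (index v) (index (partner v))
    ... | tri< lt _ _ = proj₁ (pairEdges-∋ (∈-vertices v) lt)
    ... | tri≈ _ eq _ = contradiction (trans (sym (from-index _)) (trans (cong (Inverse.from enumerate) (sym eq)) (from-index v))) ≢v
    ... | tri> _ _ gt = subst (λ x → Any (IncidentTo x) (edges fromPairing)) (involutive v)
      (proj₂ (pairEdges-∋ (∈-vertices (partner v)) (subst (λ x → index (partner v) Fin.< index x) (sym (involutive v)) gt)))

    saturated⇒moved : ∀ v → Any (IncidentTo v) (edges fromPairing) → partner v ≢ v
    saturated⇒moved v sat with find sat
    ... | edge w _ _ , e∈ , v∈e with pairEdges-∈ vertices e∈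
    saturated⇒moved v sat | edge w _ _ , e∈ , inj₁ refl | _ , refl , lt = λ eq → Fin.<-irrefl (cong index (sym eq)) lt
    saturated⇒moved v sat | edge w _ _ , e∈ , inj₂ refl | _ , refl , lt = λ eq →
      Fin.<-irrefl (cong index (trans (sym (involutive w)) eq)) lt

    fromPairing-size : 2 * size fromPairing ≡ #moved π
    fromPairing-size = trans (sym (#saturated (disjoint fromPairing)))
      (sum-cong-≗ λ i → let v = Inverse.from enumerate i in
        𝟙-cong (saturated? (edges fromPairing) v) (¬? (partner v ≟ᵛ v)) (saturated⇒moved v) (moved⇒saturated v))

    -- Both ends of an edge that could be added are unsaturated, hence fixed, and they are adjacent.
    fromPairing-maximal : Stable π → IsMaximal G fromPairing
    fromPairing-maximal stable = ¬extendable⇒maximal fromPairing λ { (edge u v u~v , e#) →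
      let fixed : ∀ w → IncidentTo w (edge u v u~v) → partner w ≡ w
          fixed w w∈e = decidable-stable (partner w ≟ᵛ w) λ ≢w →
            disjoint⇒unsaturated (edge u v u~v) e# w∈e (moved⇒saturated w ≢w)
      in stable (recompute (u ~? v) u~v) (fixed u (inj₁ refl)) (fixed v (inj₂ refl)) }

-- Saturation and matching numbers by counting moved vertices

s-attained : ∀ G → ∃ λ π → Stable {G} π × #moved π ≡ 2 * s G
s-attained G =
  let (M , max , eq) , _ = s-spec G
  in toPairing G M , toPairing-stable G M max , trans (toPairing-#moved G M) (cong (2 *_) eq)

s-least : ∀ G π → Stable {G} π → 2 * s G ≤ #moved π
s-least G π stable = subst (2 * s G ≤_) (fromPairing-size G π)
  (*-monoʳ-≤ 2 (proj₂ (s-spec G) (fromPairing G π) (fromPairing-maximal G π stable)))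

α′-attained : ∀ G → ∃ λ (π : Pairing G) → #moved π ≡ 2 * α′ G
α′-attained G = let M , _ , eq = α′-spec G in toPairing G M , trans (toPairing-#moved G M) (cong (2 *_) eq)

α′-greatest : ∀ G (π : Pairing G) → #moved π ≤ 2 * α′ G
α′-greatest G π = let M , max , eq = α′-spec G in subst (_≤ 2 * α′ G) (fromPairing-size G π)
  (*-monoʳ-≤ 2 (subst (Matchings.size G (fromPairing G π) ≤_) eq (max (fromPairing G π))))

-- All maximum matchings have the same size, so the size of `M` is `α′ G`.
#unsaturated-maximum : ∀ G M → IsMaximum G M → #unsaturated G M + 2 * α′ G ≡ Graph.order G
#unsaturated-maximum G M max =
  let M₀ , max₀ , eq = α′-spec G
  in trans (cong (λ k → #unsaturated G M + 2 * k) (trans (sym eq) (≤-antisym (max M₀) (max₀ M))))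
           (#unsaturated+2*size G M)

-- Paths with an apex

-- ⌈(m − 1)/3⌉; hence ⌈m/3⌉ is pathSat (suc m).
pathSat : ℕ → ℕ
pathSat 0 = 0
pathSat 1 = 0
pathSat 2 = 1
pathSat (suc (suc (suc m))) = suc (pathSat m)

-- The ceiling property of ⌈(m - 1)/3⌉: it turns an inequality m ≤ 3f + 1 obtained by counting into
-- a lower bound on f.
pathSat-least : ∀ m f → m ≤ suc (3 * f) → pathSat m ≤ f
pathSat-least 0 f _ = z≤n
pathSat-least 1 f _ = z≤n
pathSat-least 2 zero (s≤s ())
pathSat-least 2 (suc f) _ = s≤s z≤n
pathSat-least (suc (suc (suc m))) zero (s≤s ())
pathSat-least (suc (suc (suc m))) (suc f) le = s≤s (pathSat-least m f
  (+-cancelˡ-≤ 3 m (suc (3 * f)) (subst (λ x → 3 + m ≤ suc x) (*-suc 3 f) le)))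

-- ⌈m/3⌉ exceeds ⌈(m - 1)/3⌉ exactly when 3 divides m - 1; this is where the two cases of the
-- theorem part.
pathSat-suc-1 : ∀ m → m % 3 ≡ 1 → pathSat (suc m) ≡ suc (pathSat m)
pathSat-suc-1 0 ()
pathSat-suc-1 1 _ = refl
pathSat-suc-1 2 ()
pathSat-suc-1 (suc (suc (suc m))) eq = cong suc (pathSat-suc-1 m eq)

pathSat-suc-≢1 : ∀ m → m % 3 ≢ 1 → pathSat (suc m) ≡ pathSat m
pathSat-suc-≢1 0 _ = refl
pathSat-suc-≢1 1 ≢1 = contradiction refl ≢1
pathSat-suc-≢1 2 _ = refl
pathSat-suc-≢1 (suc (suc (suc m))) ≢1 = cong suc (pathSat-suc-≢1 m ≢1)

infix 4 _≟ᴹ_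
_≟ᴹ_ : ∀ {m} → DecidableEquality (Maybe (Fin m))
_≟ᴹ_ = Maybe.≡-dec Fin._≟_

-- A pairing of the path together with an apex, `nothing`, joined to all its vertices.
record Block (m : ℕ) : Set where
  open Graph (P m) using (_~_)
  field
    mate       : Maybe (Fin m) → Maybe (Fin m)
    involutive : ∀ z → mate (mate z) ≡ z
    adjacent   : ∀ x y → mate (just x) ≡ just y → x ≢ y → x ~ y
    stable     : ∀ x y → x ~ y → mate (just x) ≡ just x → mate (just y) ≢ just y

  moved : Maybe (Fin m) → ℕ
  moved z = 𝟙 (¬? (mate z ≟ᴹ z))

  #movedPath : ℕ
  #movedPath = sum (moved ∘ just)

  flip-mate : ∀ {y z} → mate y ≡ z → mate z ≡ y
  flip-mate {y} eq = trans (cong mate (sym eq)) (involutive y)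

-- The lower bound for a block

module _ {k} (b : Block (suc k)) where
  open Block b

  Right Left ToApex Fixed : Fin (suc k) → Set
  Right x  = ∃ λ y → mate (just x) ≡ just y × suc (toℕ x) ≡ toℕ y
  Left x   = ∃ λ y → mate (just x) ≡ just y × suc (toℕ y) ≡ toℕ x
  ToApex x = mate (just x) ≡ nothing
  Fixed x  = mate (just x) ≡ just x

  right? : ∀ x → Dec (Right x)
  right? x = Fin.any? λ y → (mate (just x) ≟ᴹ just y) ×-dec (suc (toℕ x) ℕ.≟ toℕ y)

  left? : ∀ x → Dec (Left x)
  left? x = Fin.any? λ y → (mate (just x) ≟ᴹ just y) ×-dec (suc (toℕ y) ℕ.≟ toℕ x)

  toApex? : ∀ x → Dec (ToApex x)
  toApex? x = mate (just x) ≟ᴹ nothing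

  fixed? : ∀ x → Dec (Fixed x)
  fixed? x = mate (just x) ≟ᴹ just x

  #right #left #toApex #fixed : ℕ
  #right  = sum (𝟙 ∘ right?)
  #left   = sum (𝟙 ∘ left?)
  #toApex = sum (𝟙 ∘ toApex?)
  #fixed  = sum (𝟙 ∘ fixed?)

  moved⇒ : ∀ x → ¬ Fixed x → Right x ⊎ Left x ⊎ ToApex x
  moved⇒ x ¬fixed with mate (just x) in eq
  ... | nothing = inj₂ (inj₂ refl)
  ... | just y  = [ (λ p → inj₁ (y , refl , p)) , (λ p → inj₂ (inj₁ (y , refl , p))) ]
                    (adjacent x y eq λ x≡y → ¬fixed (cong just (sym x≡y)))

  -- The only neighbours of a path vertex in its block are the next vertex, the previous one and the
  -- apex, so a moved vertex is of exactly one of three kinds.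
  moved-split : ∀ x → moved (just x) ≡ 𝟙 (right? x) + (𝟙 (left? x) + 𝟙 (toApex? x))
  moved-split x = trans
    (𝟙-⊎ (¬? (fixed? x)) (right? x) (left? x ⊎-dec toApex? x) (moved⇒ x) ⇒moved right-exclusive)
    (cong (𝟙 (right? x) +_) (𝟙-⊎ (left? x ⊎-dec toApex? x) (left? x) (toApex? x) id id
      λ { (_ , eq , _) eq′ → contradiction (trans (sym eq) eq′) λ () }))
    where
    ⇒moved : Right x ⊎ Left x ⊎ ToApex x → ¬ Fixed x
    ⇒moved (inj₁ (_ , eq , p)) eq′ =
      1+n≢n (trans p (cong toℕ (Maybe.just-injective (trans (sym eq) eq′))))
    ⇒moved (inj₂ (inj₁ (_ , eq , p))) eq′ =
      1+n≢n (trans p (cong toℕ (Maybe.just-injective (trans (sym eq′) eq))))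
    ⇒moved (inj₂ (inj₂ eq)) eq′ = contradiction (trans (sym eq) eq′) λ ()
    right-exclusive : Right x → ¬ (Left x ⊎ ToApex x)
    right-exclusive (y , eq , p) (inj₁ (_ , eq′ , q)) with refl ← Maybe.just-injective (trans (sym eq) eq′) =
      <-asym (≤-reflexive p) (≤-reflexive q)
    right-exclusive (_ , eq , _) (inj₂ eq′) = contradiction (trans (sym eq) eq′) λ ()

  -- Each path edge of the matching has one `Right` end and one `Left` end. Comparing `Right` at i
  -- with `Left` at i + 1 leaves over the last vertex, which is never `Right`, and the first, which
  -- is never `Left`.
  #right≡#left : #right ≡ #left
  #right≡#left = begin
    #right
      ≡⟨ sum-init-last (𝟙 ∘ right?) ⟩
    sum (𝟙 ∘ right? ∘ inject₁) + 𝟙 (right? (fromℕ k))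
      ≡⟨ cong₂ _+_ (sum-cong-≗ λ i → 𝟙-cong (right? (inject₁ i)) (left? (suc i)) (to i) (from i))
           (𝟙-no (right? (fromℕ k)) λ (y , _ , p) → <-irrefl (trans (sym p) (cong suc (Fin.toℕ-fromℕ k))) (Fin.toℕ<n y)) ⟩
    sum (𝟙 ∘ left? ∘ suc) + 0
      ≡⟨ +-comm _ 0 ⟩
    0 + sum (𝟙 ∘ left? ∘ suc)
      ≡⟨ cong (_+ sum (𝟙 ∘ left? ∘ suc)) (𝟙-no (left? zero) λ ()) ⟨
    #left ∎
    where
    open ≡-Reasoning
    to : ∀ i → Right (inject₁ i) → Left (suc i)
    to i (y , eq , p)
      with refl ← Fin.toℕ-injective (trans (cong suc (sym (Fin.toℕ-inject₁ i))) p) =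
      inject₁ i , flip-mate eq , p
    from : ∀ i → Left (suc i) → Right (inject₁ i)
    from i (y , eq , p)
      with refl ← Fin.toℕ-injective (trans (suc-injective p) (sym (Fin.toℕ-inject₁ i))) =
      suc i , flip-mate eq , p

  -- The right neighbour of a fixed vertex is moved, but not to its left.
  #fixed≤ : #fixed ≤ suc (#right + #toApex)
  #fixed≤ = begin
    #fixed
      ≡⟨ sum-init-last (𝟙 ∘ fixed?) ⟩
    sum (𝟙 ∘ fixed? ∘ inject₁) + 𝟙 (fixed? (fromℕ k))
      -- The last vertex has no right neighbour to be charged to, which costs the extra 1.
      ≤⟨ +-mono-≤ (sum-mono-≤ next) (𝟙≤1 (fixed? (fromℕ k))) ⟩
    sum (rest ∘ suc) + 1
      ≤⟨ +-monoˡ-≤ 1 (m≤n+m (sum (rest ∘ suc)) (rest zero)) ⟩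
    sum rest + 1
      ≡⟨ +-comm (sum rest) 1 ⟩
    suc (sum rest)
      ≡⟨ cong suc (∑-distrib-+ (𝟙 ∘ right?) (𝟙 ∘ toApex?)) ⟩
    suc (#right + #toApex) ∎
    where
    open ≤-Reasoning
    rest : Fin (suc k) → ℕ
    rest x = 𝟙 (right? x) + 𝟙 (toApex? x)
    next : ∀ i → 𝟙 (fixed? (inject₁ i)) ≤ rest (suc i)
    next i with fixed? (inject₁ i)
    ... | no _ = z≤n
    ... | yes fixed with moved⇒ (suc i) (stable (inject₁ i) (suc i) (inj₁ (cong suc (Fin.toℕ-inject₁ i))) fixed)
    ...   | inj₁ r        = ≤-trans (≤-reflexive (sym (𝟙-yes (right? (suc i)) r))) (m≤m+n _ _)
    ...   | inj₂ (inj₂ a) = ≤-trans (≤-reflexive (sym (𝟙-yes (toApex? (suc i)) a))) (m≤n+m _ (𝟙 (right? (suc i))))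
    -- Moved to its left, `suc i` would be the mate of `inject₁ i`, which is fixed.
    ...   | inj₂ (inj₁ (y , eq , p))
      with refl ← Fin.toℕ-injective {i = y} {j = inject₁ i} (trans (suc-injective p) (sym (Fin.toℕ-inject₁ i))) =
      contradiction (Maybe.just-injective (trans (sym (flip-mate eq)) fixed)) λ eq′ →
        1+n≢n (trans (cong toℕ eq′) (Fin.toℕ-inject₁ i))

  -- `mate` is an involution, so only the mate of the apex is sent to the apex, and no path vertex
  -- is when the apex is fixed.
  #toApex≡ : #toApex ≡ moved nothing
  #toApex≡ with mate nothing in eq
  ... | nothing = sum-zero λ x → 𝟙-no (toApex? x) λ eq′ → contradiction (trans (sym eq) (flip-mate eq′)) λ ()
  ... | just z  = sum-single z (𝟙-yes (toApex? z) (flip-mate eq)) λ x x≢z → 𝟙-no (toApex? x) λ eq′ →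
    x≢z (Maybe.just-injective (trans (sym (flip-mate eq′)) eq))

  -- The witness f is the number of path edges used. With a = `moved nothing` there are 2f + a moved
  -- path vertices and at most f + a + 1 fixed ones, which add up to 3f + 2a + 1.
  block-bound : ∃ λ f → #movedPath ≡ 2 * f + moved nothing × suc k ≤ suc (3 * f + 2 * moved nothing)
  block-bound = #right , trans #moved≡ (twice #right (moved nothing)) , (begin
    suc k
      ≡⟨ *-identityʳ (suc k) ⟨
    suc k * 1
      ≡⟨ sum-const (suc k) 1 ⟨
    sum {suc k} (λ _ → 1)
      ≡⟨ sum-cong-≗ (𝟙-¬ ∘ fixed?) ⟨
    sum (λ x → moved (just x) + 𝟙 (fixed? x))
      ≡⟨ ∑-distrib-+ (moved ∘ just) (𝟙 ∘ fixed?) ⟩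
    #movedPath + #fixed
      ≤⟨ +-mono-≤ (≤-reflexive #moved≡) (subst (λ a → #fixed ≤ suc (#right + a)) #toApex≡ #fixed≤) ⟩
    (#right + (#right + moved nothing)) + suc (#right + moved nothing)
      ≡⟨ sum≡ #right (moved nothing) ⟩
    suc (3 * #right + 2 * moved nothing) ∎)
    where
    open ≤-Reasoning
    twice : ∀ r a → r + (r + a) ≡ 2 * r + a
    twice = solve-∀
    sum≡ : ∀ r a → (r + (r + a)) + suc (r + a) ≡ suc (3 * r + 2 * a)
    sum≡ = solve-∀
    #moved≡ : #movedPath ≡ #right + (#right + moved nothing)
    #moved≡ = trans (sum-cong-≗ moved-split) (trans (∑-distrib-+ (𝟙 ∘ right?) (λ x → 𝟙 (left? x) + 𝟙 (toApex? x)))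
      (cong (#right +_) (trans (∑-distrib-+ (𝟙 ∘ left?) (𝟙 ∘ toApex?)) (cong₂ _+_ (sym #right≡#left) #toApex≡))))

-- Blocks attaining the bounds

module _ {m} (b : Block m) where
  open Block

  private
    shift : Maybe (Fin m) → Maybe (Fin (3 + m))
    shift = Maybe.map λ x → suc (suc (suc x))

    shift-injective : ∀ {y z} → shift y ≡ shift z → y ≡ z
    shift-injective = Maybe.map-injective λ { refl → refl }

    mate′ : Maybe (Fin (3 + m)) → Maybe (Fin (3 + m))
    mate′ nothing                    = shift (mate b nothing)
    mate′ (just zero)                = just zero
    mate′ (just (suc zero))          = just (suc (suc zero))
    mate′ (just (suc (suc zero)))    = just (suc zero)
    mate′ (just (suc (suc (suc x)))) = shift (mate b (just x))

    mate′-shift : ∀ z → mate′ (shift z) ≡ shift (mate b z)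
    mate′-shift nothing  = refl
    mate′-shift (just _) = refl

  -- A fixed vertex and a matched pair are put in front of the path: three more vertices for one
  -- more edge, as in the recursion of `pathSat`. The pair separates the new fixed vertex from the
  -- old path, so stability is inherited.
  prepend : Block (3 + m)
  prepend .mate = mate′
  prepend .involutive nothing = trans (mate′-shift _) (cong shift (involutive b nothing))
  prepend .involutive (just zero) = refl
  prepend .involutive (just (suc zero)) = refl
  prepend .involutive (just (suc (suc zero))) = refl
  prepend .involutive (just (suc (suc (suc x)))) = trans (mate′-shift _) (cong shift (involutive b (just x)))
  prepend .adjacent zero                y refl x≢y = contradiction refl x≢y
  prepend .adjacent (suc zero)          y refl _   = inj₁ refl
  prepend .adjacent (suc (suc zero))    y refl _   = inj₂ refl
  prepend .adjacent (suc (suc (suc x))) y eq   x≢y with mate b (just x) in eq′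
  prepend .adjacent (suc (suc (suc x))) .(suc (suc (suc y))) refl x≢y | just y =
    Sum.map (cong (3 +_)) (cong (3 +_)) (adjacent b x y eq′ (x≢y ∘ cong λ z → suc (suc (suc z))))
  prepend .stable zero                zero                (inj₁ ()) _ _
  prepend .stable zero                zero                (inj₂ ()) _ _
  prepend .stable zero                (suc zero)          _  _ ()
  prepend .stable zero                (suc (suc zero))    _  _ ()
  prepend .stable zero                (suc (suc (suc y))) (inj₁ ()) _ _
  prepend .stable zero                (suc (suc (suc y))) (inj₂ ()) _ _
  prepend .stable (suc zero)          _                   _  ()
  prepend .stable (suc (suc zero))    _                   _  ()
  prepend .stable (suc (suc (suc x))) zero                (inj₁ ()) _ _
  prepend .stable (suc (suc (suc x))) zero                (inj₂ ()) _ _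
  prepend .stable (suc (suc (suc x))) (suc zero)          _  _ ()
  prepend .stable (suc (suc (suc x))) (suc (suc zero))    _  _ ()
  prepend .stable (suc (suc (suc x))) (suc (suc (suc y))) x~y fx fy =
    stable b x y (Sum.map (+-cancelˡ-≡ 3 _ _) (+-cancelˡ-≡ 3 _ _) x~y) (shift-injective fx) (shift-injective fy)

  prepend-#movedPath : #movedPath prepend ≡ 2 + #movedPath b
  prepend-#movedPath = cong (2 +_) (sum-cong-≗ λ x →
    𝟙-cong (¬? (shift (mate b (just x)) ≟ᴹ shift (just x))) (¬? (mate b (just x) ≟ᴹ just x))
      (λ ≢x → ≢x ∘ cong shift) (λ ≢x → ≢x ∘ shift-injective))

  prepend-apex : mate b nothing ≡ nothing → mate prepend nothing ≡ nothing
  prepend-apex = cong shift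

  prepend-apex-moved : mate b nothing ≢ nothing → mate prepend nothing ≢ nothing
  prepend-apex-moved ≢n = ≢n ∘ shift-injective

-- Smallest maximal matchings of the path itself. The base cases are the empty path, one fixed
-- vertex and one edge.
freeBlock : ∀ m → Σ (Block m) λ b → Block.mate b nothing ≡ nothing × Block.#movedPath b ≡ 2 * pathSat m
freeBlock 0 = record { mate = id ; involutive = λ _ → refl ; adjacent = λ () ; stable = λ () } , refl , refl
freeBlock 1 = record
  { mate       = id
  ; involutive = λ _ → refl
  ; adjacent   = λ { x y refl x≢y → contradiction refl x≢y }
  ; stable     = λ { zero zero (inj₁ ()) ; zero zero (inj₂ ()) }
  } , refl , refl
freeBlock 2 = record
  { mate       = λ { nothing → nothing ; (just zero) → just (suc zero) ; (just (suc zero)) → just zero }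
  ; involutive = λ { nothing → refl ; (just zero) → refl ; (just (suc zero)) → refl }
  ; adjacent   = λ { zero y refl _ → inj₁ refl ; (suc zero) y refl _ → inj₂ refl }
  ; stable     = λ { zero _ _ () ; (suc zero) _ _ () }
  } , refl , refl
freeBlock (suc (suc (suc m))) =
  let b , apex , eq = freeBlock m
  in prepend b , prepend-apex b apex , trans (prepend-#movedPath b) (trans (cong (2 +_) eq) (sym (*-suc 2 (pathSat m))))

-- The base cases, on 1, 2 and 3 vertices, use the apex edge alone. The `suc` counts the moved apex,
-- so block and apex together reach 2⌈m/3⌉ for m = k + 1.
boundBlock : ∀ k → Σ (Block (suc k)) λ b →
  Block.mate b nothing ≢ nothing × suc (Block.#movedPath b) ≡ 2 * pathSat (suc (suc k))
boundBlock 0 = record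
  { mate       = λ { nothing → just zero ; (just zero) → nothing }
  ; involutive = λ { nothing → refl ; (just zero) → refl }
  ; adjacent   = λ { zero _ () }
  ; stable     = λ { zero _ _ () }
  } , (λ ()) , refl
boundBlock 1 = record
  { mate       = λ { nothing → just zero ; (just zero) → nothing ; (just (suc zero)) → just (suc zero) }
  ; involutive = λ { nothing → refl ; (just zero) → refl ; (just (suc zero)) → refl }
  ; adjacent   = λ { zero _ () ; (suc zero) y refl x≢y → contradiction refl x≢y }
  ; stable     = λ { zero _ _ () ; (suc zero) zero _ _ () ; (suc zero) (suc zero) (inj₁ ()) ; (suc zero) (suc zero) (inj₂ ()) }
  } , (λ ()) , refl
-- The apex takes the middle vertex, so that the two fixed ends are not adjacent.
boundBlock 2 = record
  { mate       = λ { nothing → just (suc zero) ; (just zero) → just zero ; (just (suc zero)) → nothing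
                   ; (just (suc (suc zero))) → just (suc (suc zero)) }
  ; involutive = λ { nothing → refl ; (just zero) → refl ; (just (suc zero)) → refl ; (just (suc (suc zero))) → refl }
  ; adjacent   = λ { zero y refl x≢y → contradiction refl x≢y ; (suc zero) _ ()
                   ; (suc (suc zero)) y refl x≢y → contradiction refl x≢y }
  ; stable     = λ { zero zero (inj₁ ()) ; zero zero (inj₂ ()) ; zero (suc zero) _ _ ()
                   ; zero (suc (suc zero)) (inj₁ ()) ; zero (suc (suc zero)) (inj₂ ())
                   ; (suc zero) _ _ ()
                   ; (suc (suc zero)) zero (inj₁ ()) ; (suc (suc zero)) zero (inj₂ ())
                   ; (suc (suc zero)) (suc zero) _ _ ()
                   ; (suc (suc zero)) (suc (suc zero)) (inj₁ ()) ; (suc (suc zero)) (suc (suc zero)) (inj₂ ()) }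
  } , (λ ()) , refl
boundBlock (suc (suc (suc k))) =
  let b , apex , eq = boundBlock k
  in prepend b , prepend-apex-moved b apex , trans (cong suc (prepend-#movedPath b))
       (trans (cong (2 +_) eq) (sym (*-suc 2 (pathSat (suc (suc k))))))

-- The saturation number of a path

pathBlock : ∀ {m} (π : Pairing (P m)) → Stable π → Block m
pathBlock π stable = record
  { mate       = Maybe.map partner
  ; involutive = λ { nothing → refl ; (just x) → cong just (involutive x) }
  ; adjacent   = λ { x _ refl x≢y → adjacent x (x≢y ∘ sym) }
  ; stable     = λ x y x~y fx fy → stable x~y (Maybe.just-injective fx) (Maybe.just-injective fy)
  }
  where open Pairing π

pathBlock-#movedPath : ∀ {m} (π : Pairing (P m)) (stable : Stable π) → Block.#movedPath (pathBlock π stable) ≡ #moved π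
pathBlock-#movedPath {m} π stable = sum-cong-≗ λ x →
  𝟙-cong (¬? (just (partner x) ≟ᴹ just x)) (¬? (Graph._≟ᵛ_ (P m) (partner x) x))
    (λ ≢x → ≢x ∘ cong just) (λ ≢x → ≢x ∘ Maybe.just-injective)
  where open Pairing π

module _ {m} (b : Block m) (apex : Block.mate b nothing ≡ nothing) where
  open Block b

  private
    -- The default of `fromMaybe` is never taken: the apex is its own mate, so no path vertex is
    -- sent to it.
    just-partner : ∀ x → just (fromMaybe x (mate (just x))) ≡ mate (just x)
    just-partner x with mate (just x) in eq
    ... | just _  = refl
    ... | nothing = contradiction (trans (sym apex) (flip-mate eq)) λ ()

  pathPairing : Pairing (P m)
  pathPairing = record
    { partner    = λ x → fromMaybe x (mate (just x))
    ; involutive = λ x → Maybe.just-injective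
        (trans (just-partner _) (trans (cong mate (just-partner x)) (involutive (just x))))
    ; adjacent   = λ x ≢x → adjacent x _ (sym (just-partner x)) (≢x ∘ sym)
    }

  pathPairing-stable : Stable pathPairing
  pathPairing-stable x~y fx fy =
    stable _ _ x~y (trans (sym (just-partner _)) (cong just fx)) (trans (sym (just-partner _)) (cong just fy))

  pathPairing-#moved : #moved pathPairing ≡ #movedPath
  pathPairing-#moved = sum-cong-≗ λ x →
    𝟙-cong (¬? (Graph._≟ᵛ_ (P m) (fromMaybe x (mate (just x))) x)) (¬? (mate (just x) ≟ᴹ just x))
      (λ ≢x fx → ≢x (Maybe.just-injective (trans (just-partner x) fx)))
      (λ ≢x fx → ≢x (trans (sym (just-partner x)) (cong just fx)))

-- The free block without its apex gives the upper bound. Conversely, a maximal matching of the path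
-- is a block with fixed apex, and `block-bound` with a = 0 reads m ≤ 3f + 1, where f is the size of
-- the matching.
s-path : ∀ k → s (P (suc k)) ≡ pathSat (suc k)
s-path k = ≤-antisym upper lower
  where
  upper : s (P (suc k)) ≤ pathSat (suc k)
  upper = let b , apex , eq = freeBlock (suc k) in *-cancelˡ-≤ 2
    (subst (2 * s (P (suc k)) ≤_) (trans (pathPairing-#moved b apex) eq)
      (s-least (P (suc k)) (pathPairing b apex) (pathPairing-stable b apex)))
  lower : pathSat (suc k) ≤ s (P (suc k))
  lower =
    let π , stable , eq = s-attained (P (suc k))
        f , eq′ , le = block-bound (pathBlock π stable)
        f≡s : f ≡ s (P (suc k))
        f≡s = *-cancelˡ-≡ f _ 2 (trans (sym (+-identityʳ _))
          (trans (sym eq′) (trans (pathBlock-#movedPath π stable) eq)))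
    in subst (pathSat (suc k) ≤_) f≡s
         (pathSat-least (suc k) f (subst (λ x → suc k ≤ suc x) (+-identityʳ _) le))

-- The enumeration lists the vertices of G first and then the pairs row by row; regrouping gives one
-- summand for each vertex of G with its copy of H.
∑ᵛ-corona : ∀ G H (f : Graph.Vertex (G ⊚ H) → ℕ) →
  ∑ᵛ (G ⊚ H) f ≡ ∑ᵛ G (λ u → f (inj₁ u) + ∑ᵛ H (λ x → f (inj₂ (u , x))))
∑ᵛ-corona G H f = begin
  ∑ᵛ (G ⊚ H) f
    ≡⟨ sum-↑ n F ⟩
  sum (λ i → F (i ↑ˡ n * m)) + sum (λ j → F (n ↑ʳ j))
    ≡⟨ cong₂ _+_ (sum-cong-≗ λ i → cong (f ∘ decode) (Fin.splitAt-↑ˡ n i (n * m)))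
         (trans (sum-cong-≗ λ j → cong (f ∘ decode) (Fin.splitAt-↑ʳ n (n * m) j)) (sum-combine n _)) ⟩
  sum (λ i → f (inj₁ (Inverse.from G.enumerate i))) + sum {n} (λ i → sum {m} (λ j → f (decode (inj₂ (combine i j)))))
    ≡⟨ cong (sum (λ i → f (inj₁ (Inverse.from G.enumerate i))) +_) (sum-cong-≗ {n} λ i → sum-cong-≗ {m} λ j →
         cong (f ∘ inj₂ ∘ Product.map (Inverse.from G.enumerate) (Inverse.from H.enumerate)) (Fin.remQuot-combine i j)) ⟩
  sum (λ i → f (inj₁ (Inverse.from G.enumerate i))) + ∑ᵛ G (λ u → ∑ᵛ H (λ x → f (inj₂ (u , x))))
    ≡⟨ ∑-distrib-+ {n} _ _ ⟨
  ∑ᵛ G (λ u → f (inj₁ u) + ∑ᵛ H (λ x → f (inj₂ (u , x)))) ∎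
  where
  open ≡-Reasoning
  module G = Graph G
  module H = Graph H
  n = G.order
  m = H.order
  F : Fin (n + n * m) → ℕ
  F = f ∘ Inverse.from (Graph.enumerate (G ⊚ H))
  decode : Fin n ⊎ Fin (n * m) → Graph.Vertex (G ⊚ H)
  decode = Sum.map (Inverse.from G.enumerate)
    (Product.map (Inverse.from G.enumerate) (Inverse.from H.enumerate) ∘ remQuot {n} m)

-- Coronas

module _ (G : Graph) (k : ℕ) where
  private
    module G = Graph G
    m = suc k
    module C = Graph (G ⊚ P m)

  blockMoved : Pairing (G ⊚ P m) → G.Vertex → ℕ
  blockMoved π u = Pairing.moved π (inj₁ u) + ∑ᵛ (P m) (λ x → Pairing.moved π (inj₂ (u , x)))

  ι : G.Vertex → Maybe (Fin m) → C.Vertex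
  ι u nothing  = inj₁ u
  ι u (just x) = inj₂ (u , x)

  -- Lower bounds for the blocks of a corona

  module _ (π : Pairing (G ⊚ P m)) (π-stable : Stable π) where
    open Pairing π

    private
      -- Any copy vertex is replaced by `u`, so a root matched into its own copy counts as fixed in
      -- G.
      core : G.Vertex → C.Vertex → G.Vertex
      core _ (inj₁ v) = v
      core u (inj₂ _) = u

      -- Every vertex of G becomes the apex, so a root matched to another vertex of G appears as a
      -- fixed apex in its block.
      local : C.Vertex → Maybe (Fin m)
      local (inj₁ _)       = nothing
      local (inj₂ (_ , x)) = just x

      local-ι : ∀ u z → local (ι u z) ≡ z
      local-ι u nothing  = refl
      local-ι u (just _) = refl

      core-involutive : ∀ u → core (core u (partner (inj₁ u))) (partner (inj₁ (core u (partner (inj₁ u))))) ≡ u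
      core-involutive u with partner (inj₁ u) in eq
      ... | inj₁ v = cong (core v) (trans (cong partner (sym eq)) (involutive (inj₁ u)))
      ... | inj₂ _ = cong (core u) eq

      core-adjacent : ∀ u → core u (partner (inj₁ u)) ≢ u → u G.~ core u (partner (inj₁ u))
      core-adjacent u ≢u with partner (inj₁ u) in eq
      ... | inj₁ v = subst (inj₁ u C.~_) eq (adjacent (inj₁ u) λ eq′ → ≢u (inj₁-injective (trans (sym eq) eq′)))
      ... | inj₂ _ = contradiction refl ≢u

    corePairing : Pairing G
    corePairing = record
      { partner    = λ u → core u (partner (inj₁ u))
      ; involutive = core-involutive
      ; adjacent   = core-adjacent
      }

    private
      -- Different blocks are joined only by edges of G, so `w` can lie outside the block of `u`
      -- only when both vertices belong to G.
      near : ∀ u z w → ι u z ≡ w ⊎ ι u z C.~ w → w ≡ ι u (local w) ⊎ z ≡ nothing × local w ≡ nothing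
      near u z        w              (inj₁ refl)       = inj₁ (cong (ι u) (sym (local-ι u z)))
      near u nothing  (inj₁ v)       (inj₂ _)          = inj₂ (refl , refl)
      near u nothing  (inj₂ (v , y)) (inj₂ refl)       = inj₁ refl
      near u (just x) (inj₁ v)       (inj₂ refl)       = inj₁ refl
      near u (just x) (inj₂ (v , y)) (inj₂ (refl , _)) = inj₁ refl

      partner-ι : ∀ u z → partner (ι u z) ≡ ι u (local (partner (ι u z))) ⊎ z ≡ nothing × local (partner (ι u z)) ≡ nothing
      partner-ι u z with partner (ι u z) C.≟ᵛ ι u z
      ... | yes eq = near u z _ (inj₁ (sym eq))
      ... | no ≢   = near u z _ (inj₂ (adjacent (ι u z) ≢))

      partner-just : ∀ u x {z} → local (partner (inj₂ (u , x))) ≡ z → partner (inj₂ (u , x)) ≡ ι u z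
      partner-just u x refl with partner-ι u (just x)
      ... | inj₁ eq       = eq
      ... | inj₂ (() , _)

      local-involutive : ∀ u z → local (partner (ι u (local (partner (ι u z))))) ≡ z
      local-involutive u z with partner-ι u z
      ... | inj₁ eq = trans (cong (local ∘ partner) (sym eq)) (trans (cong local (involutive (ι u z))) (local-ι u z))
      ... | inj₂ (refl , eq) = trans (cong (local ∘ partner ∘ ι u) eq) eq

    -- A root matched inside G gives a fixed apex whose path neighbours may be fixed as well; this
    -- is why `Block` demands stability among path vertices only.
    blockAt : G.Vertex → Block m
    blockAt u = record
      { mate       = λ z → local (partner (ι u z))
      ; involutive = local-involutive u
      ; adjacent   = λ x y eq x≢y → let eq′ = partner-just u x eq in
          proj₂ (subst (inj₂ (u , x) C.~_) eq′ (adjacent (inj₂ (u , x)) λ fx →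
            x≢y (Maybe.just-injective (cong local (trans (sym fx) eq′)))))
      ; stable     = λ x y x~y fx fy → π-stable (refl , x~y) (partner-just u x fx) (partner-just u y fy)
      }

    blockMoved≡ : ∀ u → blockMoved π u ≡ moved (inj₁ u) + Block.#movedPath (blockAt u)
    blockMoved≡ u = cong (moved (inj₁ u) +_) (sum-cong-≗ λ x →
      𝟙-cong (¬? (partner (inj₂ (u , x)) C.≟ᵛ inj₂ (u , x))) (¬? (local (partner (inj₂ (u , x))) ≟ᴹ just x))
        (λ ≢x → ≢x ∘ partner-just u x) (λ ≢x → ≢x ∘ cong local))

    private
      apex? : ∀ u → Dec (local (partner (inj₁ u)) ≢ nothing)
      apex? u = ¬? (local (partner (inj₁ u)) ≟ᴹ nothing)

      root? : ∀ u → Dec (partner (inj₁ u) ≢ inj₁ u)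
      root? u = ¬? (partner (inj₁ u) C.≟ᵛ inj₁ u)

      block-boundAt : ∀ u {a} → 𝟙 (apex? u) ≡ a →
        ∃ λ f → Block.#movedPath (blockAt u) ≡ 2 * f + a × m ≤ suc (3 * f + 2 * a)
      block-boundAt u refl = block-bound (blockAt u)

    -- Stability at the fixed root makes its whole copy moved. Then m = 2f ≤ 3f, that is, ⌈m/3⌉ ≤ f.
    blockMoved-unpaired : ∀ {u} → partner (inj₁ u) ≡ inj₁ u → 2 * pathSat (suc m) ≤ blockMoved π u
    blockMoved-unpaired {u} eq = let f , #path , _ = block-boundAt u (𝟙-no (apex? u) λ ≢n → ≢n (cong local eq)) in begin
      2 * pathSat (suc m)
        ≤⟨ *-monoʳ-≤ 2 (pathSat-least (suc m) f (s≤s (≤-trans (≤-reflexive (trans all-moved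
             (trans #path (+-identityʳ (2 * f))))) (*-monoˡ-≤ f {2} {3} (s≤s (s≤s z≤n)))))) ⟩
      2 * f
        ≡⟨ +-identityʳ (2 * f) ⟨
      2 * f + 0
        ≡⟨ #path ⟨
      Block.#movedPath (blockAt u)
        ≤⟨ m≤n+m _ (moved (inj₁ u)) ⟩
      moved (inj₁ u) + Block.#movedPath (blockAt u)
        ≡⟨ blockMoved≡ u ⟨
      blockMoved π u ∎
      where
      open ≤-Reasoning
      all-moved : m ≡ Block.#movedPath (blockAt u)
      all-moved = trans (sym (trans (sum-const m 1) (*-identityʳ m)))
        (sum-cong-≗ λ x → sym (𝟙-yes (¬? (Block.mate (blockAt u) (just x) ≟ᴹ just x)) λ fx →
          π-stable {inj₁ u} {inj₂ (u , x)} refl eq (partner-just u x fx)))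

    -- The root is moved but the apex of its block is fixed: `block-bound` with a = 0 gives m ≤ 3f +
    -- 1, and the root adds 1 to 2f.
    blockMoved-core : ∀ {u v} → partner (inj₁ u) ≡ inj₁ v → v ≢ u → suc (2 * pathSat m) ≤ blockMoved π u
    blockMoved-core {u} eq v≢u = let f , #path , m≤ = block-boundAt u (𝟙-no (apex? u) λ ≢n → ≢n (cong local eq)) in begin
      suc (2 * pathSat m)
        ≤⟨ s≤s (*-monoʳ-≤ 2 (pathSat-least m f (≤-trans m≤ (≤-reflexive (cong suc (+-identityʳ (3 * f))))))) ⟩
      suc (2 * f)
        ≡⟨ cong suc (+-identityʳ (2 * f)) ⟨
      1 + (2 * f + 0)
        ≡⟨ cong₂ _+_ (𝟙-yes (root? u) λ eq′ → v≢u (inj₁-injective (trans (sym eq) eq′))) #path ⟨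
      moved (inj₁ u) + Block.#movedPath (blockAt u)
        ≡⟨ blockMoved≡ u ⟨
      blockMoved π u ∎
      where open ≤-Reasoning

    -- Here a = 1: root and path have 1 + (2f + 1) = 2(f + 1) moved vertices, and m ≤ 3(f + 1).
    blockMoved-apex : ∀ {u w} → partner (inj₁ u) ≡ inj₂ w → 2 * pathSat (suc m) ≤ blockMoved π u
    blockMoved-apex {u} eq = let f , #path , m≤ = block-boundAt u (𝟙-yes (apex? u) λ eq′ →
                                   contradiction (trans (sym (cong local eq)) eq′) λ ()) in begin
      2 * pathSat (suc m)
        ≤⟨ *-monoʳ-≤ 2 (pathSat-least (suc m) (suc f) (s≤s (≤-trans m≤ (≤-reflexive (three f))))) ⟩
      2 * suc f
        ≡⟨ two f ⟩
      1 + (2 * f + 1)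
        ≡⟨ cong₂ _+_ (𝟙-yes (root? u) λ eq′ → contradiction (trans (sym eq) eq′) λ ()) #path ⟨
      moved (inj₁ u) + Block.#movedPath (blockAt u)
        ≡⟨ blockMoved≡ u ⟨
      blockMoved π u ∎
      where
      open ≤-Reasoning
      three : ∀ f → suc (3 * f + 2) ≡ 3 * suc f
      three = solve-∀
      two : ∀ f → 2 * suc f ≡ 1 + (2 * f + 1)
      two = solve-∀

    -- The first alternative also records that `corePairing` moves the root; when m ≡ 1 (mod 3) this
    -- unit makes up for the smaller bound.
    blockMoved-bound : ∀ u →
      Pairing.moved corePairing u ≡ 1 × suc (2 * pathSat m) ≤ blockMoved π u ⊎ 2 * pathSat (suc m) ≤ blockMoved π u
    blockMoved-bound u = go (partner (inj₁ u)) refl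
      where
      go : ∀ w → partner (inj₁ u) ≡ w →
        Pairing.moved corePairing u ≡ 1 × suc (2 * pathSat m) ≤ blockMoved π u ⊎ 2 * pathSat (suc m) ≤ blockMoved π u
      go (inj₂ _) eq = inj₂ (blockMoved-apex eq)
      go (inj₁ v) eq = case v G.≟ᵛ u of λ
        { (yes refl) → inj₂ (blockMoved-unpaired eq)
        ; (no v≢u)   → inj₁ (𝟙-yes (¬? (core u (partner (inj₁ u)) G.≟ᵛ u))
            (λ fixed → v≢u (trans (sym (cong (core u) eq)) fixed)) , blockMoved-core eq v≢u) }

  -- A stable pairing of the corona from a pairing of G

  module _ (g : Pairing G) where
    open Pairing g hiding (#moved; Stable)

    private
      free : Block m
      free = proj₁ (freeBlock m)
      free-apex : Block.mate free nothing ≡ nothing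
      free-apex = proj₁ (proj₂ (freeBlock m))
      bound : Block m
      bound = proj₁ (boundBlock k)
      bound-apex : Block.mate bound nothing ≢ nothing
      bound-apex = proj₁ (proj₂ (boundBlock k))

      extend : C.Vertex → C.Vertex
      extend (inj₁ u) with partner u G.≟ᵛ u
      ... | yes _ = ι u (Block.mate bound nothing)
      ... | no _  = inj₁ (partner u)
      extend (inj₂ (u , x)) with partner u G.≟ᵛ u
      ... | yes _ = ι u (Block.mate bound (just x))
      ... | no _  = ι u (Block.mate free (just x))

      ι-injective : ∀ {u y z} → ι u y ≡ ι u z → y ≡ z
      ι-injective {y = nothing} {nothing} _    = refl
      ι-injective {y = just _}  {just _}  refl = refl

      extend-fixed : ∀ u → partner u ≡ u → ∀ z → extend (ι u z) ≡ ι u (Block.mate bound z)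
      extend-fixed u fixed nothing with partner u G.≟ᵛ u
      ... | yes _ = refl
      ... | no ≢u = contradiction fixed ≢u
      extend-fixed u fixed (just x) with partner u G.≟ᵛ u
      ... | yes _ = refl
      ... | no ≢u = contradiction fixed ≢u

      extend-core : ∀ u → partner u ≢ u → extend (inj₁ u) ≡ inj₁ (partner u)
      extend-core u ≢u with partner u G.≟ᵛ u
      ... | yes fixed = contradiction fixed ≢u
      ... | no _      = refl

      extend-path : ∀ u → partner u ≢ u → ∀ z → z ≢ nothing → extend (ι u z) ≡ ι u (Block.mate free z)
      extend-path u ≢u nothing  ≢n = contradiction refl ≢n
      extend-path u ≢u (just x) _ with partner u G.≟ᵛ u
      ... | yes fixed = contradiction fixed ≢u
      ... | no _      = refl

      free-just : ∀ x → Block.mate free (just x) ≢ nothing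
      free-just x eq = contradiction (trans (sym free-apex) (Block.flip-mate free eq)) λ ()

      moved-partner : ∀ {u} → partner u ≢ u → partner (partner u) ≢ partner u
      moved-partner ≢u eq = ≢u (trans (sym eq) (involutive _))

      -- Over a vertex fixed by `g` the root and its path form one block and are treated alike; over
      -- a moved vertex the root follows `g` and only the path follows a block.
      data View : C.Vertex → Set where
        fixed : ∀ u z → partner u ≡ u → View (ι u z)
        core  : ∀ u → partner u ≢ u → View (inj₁ u)
        path  : ∀ u x → partner u ≢ u → View (inj₂ (u , x))

      view : ∀ w → View w
      view (inj₁ u) with partner u G.≟ᵛ u
      ... | yes eq = fixed u nothing eq
      ... | no ≢u  = core u ≢u
      view (inj₂ (u , x)) with partner u G.≟ᵛ u
      ... | yes eq = fixed u (just x) eq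
      ... | no ≢u  = path u x ≢u

      extend-involutive : ∀ w → extend (extend w) ≡ w
      extend-involutive w with view w
      ... | fixed u z eq = trans (cong extend (extend-fixed u eq z))
              (trans (extend-fixed u eq _) (cong (ι u) (Block.involutive bound z)))
      ... | core u ≢u    = trans (cong extend (extend-core u ≢u))
              (trans (extend-core (partner u) (moved-partner ≢u)) (cong inj₁ (involutive u)))
      ... | path u x ≢u  = trans (cong extend (extend-path u ≢u (just x) λ ()))
              (trans (extend-path u ≢u _ (free-just x)) (cong (ι u) (Block.involutive free (just x))))

      ι-adjacent : (b : Block m) → ∀ u z → Block.mate b z ≢ z → ι u z C.~ ι u (Block.mate b z)
      ι-adjacent b u nothing ≢z with Block.mate b nothing
      ... | nothing = contradiction refl ≢z
      ... | just _  = refl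
      ι-adjacent b u (just x) ≢z with Block.mate b (just x) in eq
      ... | nothing = refl
      ... | just y  = refl , Block.adjacent b x y eq λ x≡y → ≢z (cong just (sym x≡y))

      extend-adjacent : ∀ w → extend w ≢ w → w C.~ extend w
      extend-adjacent w ≢w with view w
      ... | fixed u z eq = subst (ι u z C.~_) (sym (extend-fixed u eq z))
              (ι-adjacent bound u z λ fz → ≢w (trans (extend-fixed u eq z) (cong (ι u) fz)))
      ... | core u ≢u    = subst (inj₁ u C.~_) (sym (extend-core u ≢u)) (adjacent u ≢u)
      ... | path u x ≢u  = subst (inj₂ (u , x) C.~_) (sym (extend-path u ≢u (just x) λ ()))
              (ι-adjacent free u (just x) λ fx → ≢w (trans (extend-path u ≢u (just x) λ ()) (cong (ι u) fx)))

    -- Attach to each vertex fixed by g a block using its apex, to each other vertex a free block.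
    extendPairing : Pairing (G ⊚ P m)
    extendPairing = record { partner = extend ; involutive = extend-involutive ; adjacent = extend-adjacent }

    private
      -- A root is matched inside G or, through `bound`, into its copy. Stability then has to be
      -- checked only between vertices of one copy.
      core-moved : ∀ u → extend (inj₁ u) ≢ inj₁ u
      core-moved u eq with partner u G.≟ᵛ u
      ... | yes _ = bound-apex (ι-injective {u} eq)
      ... | no ≢u = ≢u (inj₁-injective eq)

      fixedBlock : ∀ u → Σ (Block m) λ b → ∀ x → extend (inj₂ (u , x)) ≡ ι u (Block.mate b (just x))
      fixedBlock u with partner u G.≟ᵛ u
      ... | yes _ = bound , λ _ → refl
      ... | no _  = free , λ _ → refl

    extendPairing-stable : Stable extendPairing
    extendPairing-stable {inj₁ u}       {_}            _ fu _ = core-moved u fu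
    extendPairing-stable {inj₂ _}       {inj₁ v}       _ _ fv = core-moved v fv
    extendPairing-stable {inj₂ (u , x)} {inj₂ (v , y)} (refl , x~y) fx fy =
      let b , eq = fixedBlock u in
      Block.stable b x y x~y (ι-injective {u} (trans (sym (eq x)) fx)) (ι-injective {u} (trans (sym (eq y)) fy))

    -- Equality holds in the bounds of `blockMoved-bound`; the root always contributes 1.
    extendPairing-blockMoved : ∀ u →
      (moved u ≡ 1 × blockMoved extendPairing u ≡ suc (2 * pathSat m)) ⊎
      (moved u ≡ 0 × blockMoved extendPairing u ≡ 2 * pathSat (suc m))
    extendPairing-blockMoved u = case partner u G.≟ᵛ u of λ
      { (no ≢u) → inj₁ (𝟙-yes (¬? (partner u G.≟ᵛ u)) ≢u ,
          trans (count free λ x → extend-path u ≢u (just x) λ ()) (cong suc (proj₂ (proj₂ (freeBlock m)))))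
      ; (yes eq) → inj₂ (𝟙-no (¬? (partner u G.≟ᵛ u)) (λ ≢u → ≢u eq) ,
          trans (count bound λ x → extend-fixed u eq (just x)) (proj₂ (proj₂ (boundBlock k)))) }
      where
      count : (b : Block m) → (∀ x → extend (inj₂ (u , x)) ≡ ι u (Block.mate b (just x))) →
        blockMoved extendPairing u ≡ suc (Block.#movedPath b)
      count b eq = cong₂ _+_ (𝟙-yes (¬? (extend (inj₁ u) C.≟ᵛ inj₁ u)) (core-moved u))
        (sum-cong-≗ λ x → 𝟙-cong (¬? (extend (inj₂ (u , x)) C.≟ᵛ inj₂ (u , x))) (¬? (Block.mate b (just x) ≟ᴹ just x))
          (λ ≢x fx → ≢x (trans (eq x) (cong (ι u) fx)))
          (λ ≢x fx → ≢x (ι-injective {u} (trans (sym (eq x)) fx))))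

idPairing : ∀ G → Pairing G
idPairing G = record { partner = id ; involutive = λ _ → refl ; adjacent = λ _ ≢v → contradiction refl ≢v }

∑ᵛ-const : ∀ G (f : Graph.Vertex G → ℕ) {c} → (∀ v → f v ≡ c) → ∑ᵛ G f ≡ Graph.order G * c
∑ᵛ-const G f f≡c = trans (sum-cong-≗ (f≡c ∘ Inverse.from (Graph.enumerate G))) (sum-const (Graph.order G) _)

∑ᵛ-lower : ∀ G (f : Graph.Vertex G → ℕ) {c} → (∀ v → c ≤ f v) → Graph.order G * c ≤ ∑ᵛ G f
∑ᵛ-lower G f {c} c≤f = subst (_≤ ∑ᵛ G f) (sum-const (Graph.order G) c) (sum-mono-≤ (c≤f ∘ Inverse.from (Graph.enumerate G)))

-- The saturation number of the corona

module _ (G : Graph) (k : ℕ) where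
  private
    m = suc k
    n = Graph.order G
    C = G ⊚ P m

    swap-2 : ∀ a b → a * (2 * b) ≡ 2 * (a * b)
    swap-2 = solve-∀

  -- Here ⌈m/3⌉ = ⌈(m - 1)/3⌉, so matching a root inside G saves nothing and costs one more moved
  -- vertex.
  s-corona-≢1 : m % 3 ≢ 1 → s C ≡ n * s (P m)
  s-corona-≢1 m≢1 = trans (≤-antisym (*-cancelˡ-≤ 2 upper) (*-cancelˡ-≤ 2 lower)) (cong (n *_) (sym (s-path k)))
    where
    open ≤-Reasoning
    rate≡ : 2 * pathSat (suc m) ≡ 2 * pathSat m
    rate≡ = cong (2 *_) (pathSat-suc-≢1 m m≢1)

    -- Starting from the empty matching of G, every root is matched into its own copy.
    π₀ : Pairing C
    π₀ = extendPairing G k (idPairing G)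

    upper-at : ∀ u → blockMoved G k π₀ u ≡ 2 * pathSat m
    upper-at u with extendPairing-blockMoved G k (idPairing G) u
    ... | inj₁ (≡1 , _) = contradiction (trans (sym ≡1) (𝟙-no (¬? (Graph._≟ᵛ_ G u u)) λ ≢u → ≢u refl)) λ ()
    ... | inj₂ (_ , eq) = trans eq rate≡

    upper : 2 * s C ≤ 2 * (n * pathSat m)
    upper = begin
      2 * s C                    ≤⟨ s-least C π₀ (extendPairing-stable G k (idPairing G)) ⟩
      #moved π₀                  ≡⟨ ∑ᵛ-corona G (P m) (Pairing.moved π₀) ⟩
      ∑ᵛ G (blockMoved G k π₀)   ≡⟨ ∑ᵛ-const G (blockMoved G k π₀) upper-at ⟩
      n * (2 * pathSat m)        ≡⟨ swap-2 n (pathSat m) ⟩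
      2 * (n * pathSat m)        ∎

    lower-at : ∀ π → Stable π → ∀ u → 2 * pathSat m ≤ blockMoved G k π u
    lower-at π stable u with blockMoved-bound G k π stable u
    ... | inj₁ (_ , le) = <⇒≤ le
    ... | inj₂ le       = subst (_≤ blockMoved G k π u) rate≡ le

    lower : 2 * (n * pathSat m) ≤ 2 * s C
    lower = let π , stable , eq = s-attained C in begin
      2 * (n * pathSat m)       ≡⟨ swap-2 n (pathSat m) ⟨
      n * (2 * pathSat m)       ≤⟨ ∑ᵛ-lower G (blockMoved G k π) (lower-at π stable) ⟩
      ∑ᵛ G (blockMoved G k π)   ≡⟨ ∑ᵛ-corona G (P m) (Pairing.moved π) ⟨
      #moved π                  ≡⟨ eq ⟩
      2 * s C                   ∎

  -- A root matched inside G leaves 2p + 1 moved vertices in its block instead of 2p + 2, so a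
  -- maximum matching of G saves `α′ G` edges. The additive form avoids a truncated difference.
  s-corona-1 : m % 3 ≡ 1 → s C + α′ G ≡ n * suc (s (P m))
  s-corona-1 m≡1 = trans (≤-antisym (*-cancelˡ-≤ 2 upper) (*-cancelˡ-≤ 2 lower)) (cong (λ x → n * suc x) (sym (s-path k)))
    where
    open ≤-Reasoning
    p = pathSat m

    rate≡ : 2 * pathSat (suc m) ≡ 2 * suc p
    rate≡ = cong (2 *_) (pathSat-suc-1 m m≡1)

    2+2p : ∀ p → suc (2 * p) + 1 ≡ 2 * suc p
    2+2p = solve-∀

    -- Adding `moved g u` pays back the vertex saved by a root matched inside G, which brings both
    -- kinds of block to the same value 2(p + 1).
    weight : Pairing C → Pairing G → Graph.Vertex G → ℕ
    weight π g u = blockMoved G k π u + Pairing.moved g u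

    ∑-weight : ∀ π g → ∑ᵛ G (weight π g) ≡ #moved π + #moved g
    ∑-weight π g = trans (∑-distrib-+ {n} _ _) (cong (_+ #moved g) (sym (∑ᵛ-corona G (P m) (Pairing.moved π))))

    upper-at : ∀ g u → weight (extendPairing G k g) g u ≡ 2 * suc p
    upper-at g u with extendPairing-blockMoved G k g u
    ... | inj₁ (≡1 , eq) = trans (cong₂ _+_ eq ≡1) (2+2p p)
    ... | inj₂ (≡0 , eq) = trans (cong₂ _+_ eq ≡0) (trans (+-identityʳ _) rate≡)

    upper : 2 * (s C + α′ G) ≤ 2 * (n * suc p)
    upper = let g , #g = α′-attained G ; π = extendPairing G k g in begin
      2 * (s C + α′ G)       ≡⟨ *-distribˡ-+ 2 (s C) (α′ G) ⟩
      2 * s C + 2 * α′ G     ≤⟨ +-mono-≤ (s-least C π (extendPairing-stable G k g)) (≤-reflexive (sym #g)) ⟩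
      #moved π + #moved g    ≡⟨ ∑-weight π g ⟨
      ∑ᵛ G (weight π g)      ≡⟨ ∑ᵛ-const G (weight π g) (upper-at g) ⟩
      n * (2 * suc p)        ≡⟨ swap-2 n (suc p) ⟩
      2 * (n * suc p)        ∎

    lower-at : ∀ π (stable : Stable π) u → 2 * suc p ≤ weight π (corePairing G k π stable) u
    lower-at π stable u with blockMoved-bound G k π stable u
    ... | inj₁ (≡1 , le) = subst (_≤ weight π (corePairing G k π stable) u) (2+2p p) (+-mono-≤ le (≤-reflexive (sym ≡1)))
    ... | inj₂ le        = subst (_≤ weight π (corePairing G k π stable) u) rate≡ (≤-trans le (m≤m+n _ (Pairing.moved (corePairing G k π stable) u)))

    lower : 2 * (n * suc p) ≤ 2 * (s C + α′ G)
    -- The compensating pairing is the one that `π` itself induces on G; it has at most `α′ G`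
    -- edges.
    lower = let π , stable , eq = s-attained C ; g = corePairing G k π stable in begin
      2 * (n * suc p)        ≡⟨ swap-2 n (suc p) ⟨
      n * (2 * suc p)        ≤⟨ ∑ᵛ-lower G (weight π g) (lower-at π stable) ⟩
      ∑ᵛ G (weight π g)      ≡⟨ ∑-weight π g ⟩
      #moved π + #moved g    ≤⟨ +-mono-≤ (≤-reflexive eq) (α′-greatest G g) ⟩
      2 * s C + 2 * α′ G     ≡⟨ *-distribˡ-+ 2 (s C) (α′ G) ⟨
      2 * (s C + α′ G)       ∎

theorem2p4 : (G : Graph) (m : ℕ) → m ≥ 1 →
    let n = Graph.order G
        l = n ∸ 2 * α′ G
    in ((M : Matching G) → IsMaximum G M → #unsaturated G M ≡ l)
       × (m % 3 ≡ 1 → s (G ⊚ P m) ≡ n * s (P m) + α′ G + l)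
       × (m % 3 ≢ 1 → s (G ⊚ P m) ≡ n * s (P m))
theorem2p4 G (suc k) _ = #unsat≡ , case-1 , s-corona-≢1 G k
  where
  n = Graph.order G
  #unsat≡ : (M : Matching G) → IsMaximum G M → #unsaturated G M ≡ n ∸ 2 * α′ G
  #unsat≡ M max = trans (sym (m+n∸n≡m (#unsaturated G M) (2 * α′ G))) (cong (_∸ 2 * α′ G) (#unsaturated-maximum G M max))
  2α′≤n : 2 * α′ G ≤ n
  2α′≤n = let M , max , _ = α′-spec G in ≤-trans (m≤n+m _ (#unsaturated G M)) (≤-reflexive (#unsaturated-maximum G M max))
  -- With n = l + 2a, the left side is the claimed value plus a = `α′ G`, and the right side is the
  -- total in `s-corona-1`.
  rearrange : ∀ l a p → (l + 2 * a) * p + a + l + a ≡ (l + 2 * a) * suc p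
  rearrange = solve-∀
  case-1 : suc k % 3 ≡ 1 → s (G ⊚ P (suc k)) ≡ n * s (P (suc k)) + α′ G + (n ∸ 2 * α′ G)
  case-1 m≡1 = +-cancelʳ-≡ (α′ G) _ _ (trans (s-corona-1 G k m≡1)
    -- The inequality `2α′≤n` makes the truncated difference l exact, so l + 2a can be replaced by n
    -- while the separate summand l stays.
    (sym (subst (λ x → x * s (P (suc k)) + α′ G + (n ∸ 2 * α′ G) + α′ G ≡ x * suc (s (P (suc k))))
      (m∸n+n≡m 2α′≤n) (rearrange (n ∸ 2 * α′ G) (α′ G) (s (P (suc k)))))))
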